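{- Let $d\ge1$ and let $\kappa$ and $\lambda$ be regular uncountable cardinals. For every $q<\omega$ and every $d$-colored ordinal $\mathfrak A=(\lambda,<,C_0,\dots,C_{d-1})$ there is a $d$-colored ordinal $\mathfrak B=(\kappa,<,D_0,\dots,D_{d-1})$ such that $\mathfrak A\equiv_q\mathfrak B$.
   Context: A $d$-colored ordinal is a structure $(A,<,C_0,\dots,C_{d-1})$ where $(A,<)$ is an ordinal and the unary predicates $C_i$ partition $A$. $\mathfrak A\equiv_q\mathfrak B$ means agreement on all first-order sentences of quantifier rank at most $q$ in the language with the order and $d$ unary color predicates. -}

module Defs where

open import Level using (Level; suc)
open import Data.Fin.Base using (Fin)
open import Data.Nat.Base as ℕ using (ℕ; _⊔_)
open import Data.Product using (Σ-syntax; ∃-syntax; ∃!; _×_)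
open import Data.Sum.Base using (_⊎_)
open import Data.Vec.Base using (Vec; []; _∷_; lookup)
open import Function.Bundles using (_⇔_; _↣_; _⤖_)
open import Induction.WellFounded using (WellFounded)
open import Relation.Binary.Core using (Rel)
open import Relation.Binary.Definitions using (Irrelevant)
open import Relation.Binary.PropositionalEquality.Core using (_≡_)
open import Relation.Binary.Structures using (IsStrictTotalOrder)
open import Relation.Nullary.Negation.Core using (¬_)
open import Relation.Unary using (Pred)

-- An ordinal is given by a well-ordered type representing it. Irrelevance
-- of _<_ makes Below a, the ordinal a itself, a genuine subset of Carrier.

record Ordinal (ℓ : Level) : Set (suc ℓ) where
  infix 4 _<_
  field
    Carrier            : Set ℓ
    _<_                : Rel Carrier ℓ
    isStrictTotalOrder : IsStrictTotalOrder _≡_ _<_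
    wellFounded        : WellFounded _<_
    <-irrelevant       : Irrelevant _<_

  Below : Carrier → Set ℓ
  Below a = Σ[ x ∈ Carrier ] x < a

-- The ordinals smaller than κ are, up to isomorphism, the Below a.

module _ {ℓ : Level} (κ : Ordinal ℓ) where
  open Ordinal κ

  IsCardinal : Set ℓ
  IsCardinal = ∀ a → ¬ (Carrier ⤖ Below a)

  Cofinal : ∀ {a} → (Below a → Carrier) → Set ℓ
  Cofinal f = ∀ b → ∃[ x ] ¬ (f x < b)

  -- cf κ = κ, for infinite κ

  IsRegular : Set ℓ
  IsRegular = ∀ a (f : Below a → Carrier) → ¬ Cofinal f

  IsUncountable : Set ℓ
  IsUncountable = ¬ (Carrier ↣ ℕ)

  record IsRegularUncountableCardinal : Set ℓ where
    field
      isCardinal    : IsCardinal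
      isRegular     : IsRegular
      isUncountable : IsUncountable

-- Some colour classes may be empty.

record ColoredOrdinal {ℓ : Level} (d : ℕ) (α : Ordinal ℓ) : Set (suc ℓ) where
  open Ordinal α
  field
    Color     : Fin d → Pred Carrier ℓ
    partition : ∀ a → ∃! _≡_ λ i → Color i a

infix  8 _≐_ _≺_
infix  7 ~_
infixr 6 _∧_
infixr 5 _∨_
infixr 4 _⇒_

-- Formula d n has its free variables among n de Bruijn indices, index zero
-- being bound by the innermost quantifier.

data Formula (d : ℕ) : ℕ → Set where
  _≐_ _≺_     : ∀ {n} → Fin n → Fin n → Formula d n
  color       : ∀ {n} → Fin d → Fin n → Formula d n
  ~_          : ∀ {n} → Formula d n → Formula d n
  _∧_ _∨_ _⇒_ : ∀ {n} → Formula d n → Formula d n → Formula d n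
  all ex      : ∀ {n} → Formula d (ℕ.suc n) → Formula d n

Sentence : ℕ → Set
Sentence d = Formula d 0

quantifierRank : ∀ {d n} → Formula d n → ℕ
quantifierRank (x ≐ y)     = 0
quantifierRank (x ≺ y)     = 0
quantifierRank (color i x) = 0
quantifierRank (~ φ)       = quantifierRank φ
quantifierRank (φ ∧ ψ)     = quantifierRank φ ⊔ quantifierRank ψ
quantifierRank (φ ∨ ψ)     = quantifierRank φ ⊔ quantifierRank ψ
quantifierRank (φ ⇒ ψ)     = quantifierRank φ ⊔ quantifierRank ψ
quantifierRank (all φ)     = ℕ.suc (quantifierRank φ)
quantifierRank (ex φ)      = ℕ.suc (quantifierRank φ)

module _ {ℓ : Level} {d : ℕ} {α : Ordinal ℓ} (𝔄 : ColoredOrdinal d α) where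
  open Ordinal α
  open ColoredOrdinal 𝔄

  Satisfies : ∀ {n} → Vec Carrier n → Formula d n → Set ℓ
  Satisfies ρ (x ≐ y)     = lookup ρ x ≡ lookup ρ y
  Satisfies ρ (x ≺ y)     = lookup ρ x < lookup ρ y
  Satisfies ρ (color i x) = Color i (lookup ρ x)
  Satisfies ρ (~ φ)       = ¬ Satisfies ρ φ
  Satisfies ρ (φ ∧ ψ)     = Satisfies ρ φ × Satisfies ρ ψ
  Satisfies ρ (φ ∨ ψ)     = Satisfies ρ φ ⊎ Satisfies ρ ψ
  Satisfies ρ (φ ⇒ ψ)     = Satisfies ρ φ → Satisfies ρ ψ
  Satisfies ρ (all φ)     = ∀ a → Satisfies (a ∷ ρ) φ
  Satisfies ρ (ex φ)      = ∃[ a ] Satisfies (a ∷ ρ) φ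

infix 4 _⊨_ _≡[_]_

_⊨_ : ∀ {ℓ d} {α : Ordinal ℓ} → ColoredOrdinal d α → Sentence d → Set ℓ
𝔄 ⊨ φ = Satisfies 𝔄 [] φ

_≡[_]_ : ∀ {ℓ d} {α β : Ordinal ℓ} →
         ColoredOrdinal d α → ℕ → ColoredOrdinal d β → Set ℓ
𝔄 ≡[ q ] 𝔅 = ∀ φ → quantifierRank φ ℕ.≤ q → (𝔄 ⊨ φ) ⇔ (𝔅 ⊨ φ)

{-# OPTIONS --safe #-}

-- In λ, the points δ such that [x, δ) ≡_q [x, ∞) for all x < δ contain a club.
-- Finitely many q-types occur, so there are such points s₀ < s₁ < … whose tails
-- [sₙ, ∞) all have the same q-type. With M = [s₀, s₁), the sums M · n (n ≥ 1)
-- and M · ω are then [s₀, sₙ) and [s₀, sup sₙ) up to ≡_q, so they have the q-type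
-- of M, as does [s₀, ∞). This implies M · α ≡_q M for every ordinal α ≥ 1, by
-- induction on the number of rounds. Replacing [0, s₀) and M by countable Skolem
-- hulls N₀ and N₁ gives 𝔄 ≡_q N₀ + N₁ · κ, and by regularity of κ the right-hand
-- side has order type κ.

module Submission where

open import Defs
open import Axiom.ExcludedMiddle using (ExcludedMiddle)
open import Data.Bool.Base using (if_then_else_)
open import Data.Empty using (⊥-elim)
open import Data.Fin.Base using (Fin; toℕ; combine; funToFin; finToFun)
  renaming (zero to fzero; suc to fsuc)
open import Data.Fin.Properties using (combine-injective; finToFun-funToFin; toℕ-injective)
open import Data.Maybe.Base using (Maybe; just; nothing)
open import Data.Maybe.Properties using (just-injective)
open import Data.Nat.Base as ℕ using (ℕ; zero; suc; _≤_; z≤n; s≤s)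
open import Data.Nat.Induction using () renaming (<-wellFounded to ℕ-wellFounded)
open import Data.Nat.Properties as ℕ using ()
open import Data.Product using (Σ-syntax; ∃-syntax; ∃; _×_; _,_; proj₁; proj₂; swap)
open import Data.Product.Properties using (,-injectiveˡ)
open import Data.Product.Relation.Binary.Lex.Strict using (×-Lex; ×-wellFounded)
open import Data.Sum.Base using (_⊎_; inj₁; inj₂; [_,_])
open import Data.Unit.Polymorphic.Base using (⊤; tt)
open import Data.Vec.Base using (Vec; []; _∷_; lookup)
open import Function.Base using (id; _∘_; flip)
open import Function.Bundles using (_⇔_; Equivalence; mk⇔; mk↣)
open import Induction.WellFounded using (WellFounded; Acc; acc)
open import Level as L using (Level; Lift; lift; lower)
open import Relation.Binary.Core using (Rel)
open import Relation.Binary.Definitions using (Trichotomous; tri<; tri≈; tri>)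
open import Relation.Binary.PropositionalEquality
  using (_≡_; refl; sym; trans; cong; subst; isEquivalence)
open import Relation.Binary.Structures using (IsStrictTotalOrder)
open import Relation.Binary.Structures.Biased using (isStrictTotalOrderᶜ)
open import Relation.Nullary using (¬_; Dec; yes; no; does)
open import Relation.Nullary.Decidable using (decidable-stable)
open import Relation.Unary using (Pred)

-- Two mismatches between the cardinals shape the construction. If `λ` exceeds `κ`, a segment of `𝔄`
-- may be too long to fit below `κ`; countable hulls remove this, because a union of fewer than `κ`
-- countable sets stays bounded in `κ`. And a sum of `κ` blocks can have limits of cofinalities that
-- do not occur in `𝔄` (take `λ` = ω₁ and `κ` = ω₂), so segments of `𝔄` cannot serve as models for
-- its segments. Hence absorption is proved for all ordinals at once: after a move, the blocks
-- before and after the one played form sums with one round fewer to go, and by induction all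
-- nonempty ones look like `M`, whatever their cofinality.
--
-- The points `sₙ` need two kinds of finiteness. For each `x` finitely many representatives realise
-- all profiles over the tail after `x`, which gives closure points; and finitely many codes force
-- one of them to recur unboundedly among the tails at closure points.

private
  variable
    d : ℕ
    ℓ : Level

-- Coloured linear orders, their subsets and the game

record Chain (d : ℕ) (ℓ : Level) : Set (L.suc ℓ) where
  infix 4 _<_
  field
    Carrier            : Set ℓ
    _<_                : Rel Carrier ℓ
    isStrictTotalOrder : IsStrictTotalOrder _≡_ _<_
    colour             : Carrier → Fin d

  open IsStrictTotalOrder isStrictTotalOrder public
    using (compare; asym) renaming (trans to <-trans)

  irrefl : ∀ {x y} → x ≡ y → ¬ x < y
  irrefl = IsStrictTotalOrder.irrefl isStrictTotalOrder

infix 5 _↾_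

-- A subset is a predicate on a fixed carrier, so cutting an interval again changes only the
-- predicate, and two descriptions of one interval are compared by `≈-ext`.
record Part (d : ℕ) (ℓ : Level) : Set (L.suc ℓ) where
  constructor _↾_
  field
    chain : Chain d ℓ
    part  : Pred (Chain.Carrier chain) ℓ

open Part

∣_∣ : Part d ℓ → Set ℓ
∣ S ∣ = Chain.Carrier (chain S)

infix 4 _∋_ less

_∋_ : (S : Part d ℓ) → Pred ∣ S ∣ ℓ
_∋_ = part

less : (S : Part d ℓ) → Rel ∣ S ∣ ℓ
less S = Chain._<_ (chain S)

syntax less S x y = x <[ S ] y

colour : (S : Part d ℓ) → ∣ S ∣ → Fin d
colour S = Chain.colour (chain S)

infixl 6 _∩_ _↓_ _↑_

_∩_ : (S : Part d ℓ) → Pred ∣ S ∣ ℓ → Part d ℓ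
S ∩ P = chain S ↾ λ z → S ∋ z × P z

_↓_ _↑_ : (S : Part d ℓ) → ∣ S ∣ → Part d ℓ
S ↓ x = S ∩ λ z → z <[ S ] x
S ↑ x = S ∩ λ z → x <[ S ] z

-- Duplicator wins the q-round Ehrenfeucht–Fraïssé game. A move splits both
-- chains at the chosen points, after which the two sides are independent.

infix 4 _≈[_]_ _≼[_]_

_≈[_]_ _≼[_]_ : Part d ℓ → ℕ → Part d ℓ → Set ℓ

S ≈[ zero  ] T = ⊤
S ≈[ suc q ] T = S ≼[ q ] T × T ≼[ q ] S

S ≼[ q ] T = ∀ x → S ∋ x → Σ[ y ∈ ∣ T ∣ ]
  (T ∋ y × colour S x ≡ colour T y × S ↓ x ≈[ q ] T ↓ y × S ↑ x ≈[ q ] T ↑ y)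

≈-sym : ∀ q {S T : Part d ℓ} → S ≈[ q ] T → T ≈[ q ] S
≈-sym zero    _ = tt
≈-sym (suc q)   = swap

≈-trans : ∀ q {S T U : Part d ℓ} → S ≈[ q ] T → T ≈[ q ] U → S ≈[ q ] U
≈-trans zero _ _ = tt
≈-trans {d = d} {ℓ} (suc q) {S} {T} {U} (S≼T , T≼S) (T≼U , U≼T) =
  ≼-trans {S} {T} {U} S≼T T≼U , ≼-trans {U} {T} {S} U≼T T≼S
  where
  ≼-trans : {S T U : Part d ℓ} → S ≼[ q ] T → T ≼[ q ] U → S ≼[ q ] U
  ≼-trans f g x x∈S =
    let y , y∈T , c , l , r = f x x∈S
        z , z∈U , c′ , l′ , r′ = g y y∈T
    in z , z∈U , trans c c′ , ≈-trans q l l′ , ≈-trans q r r′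

≈-weaken : ∀ q {S T : Part d ℓ} → S ≈[ suc q ] T → S ≈[ q ] T
≈-weaken zero _ = tt
≈-weaken {d = d} {ℓ} (suc q) {S} {T} (S≼T , T≼S) = ≼-weaken {S} {T} S≼T , ≼-weaken {T} {S} T≼S
  where
  ≼-weaken : {S T : Part d ℓ} → S ≼[ suc q ] T → S ≼[ q ] T
  ≼-weaken f x x∈S =
    let y , y∈T , c , l , r = f x x∈S in y , y∈T , c , ≈-weaken q l , ≈-weaken q r

≈-weaken-≤ : ∀ {k q} {S T : Part d ℓ} → k ≤ q → S ≈[ q ] T → S ≈[ k ] T
≈-weaken-≤ {d = d} {ℓ} {k} {S = S} {T} k≤q = go (ℕ.≤⇒≤′ k≤q)
  where
  go : ∀ {q} → k ℕ.≤′ q → S ≈[ q ] T → S ≈[ k ] T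
  go ℕ.≤′-refl         e = e
  go (ℕ.≤′-step k≤′q) e = go k≤′q (≈-weaken _ e)

-- A relation instead of a function asks for no values outside the parts, and the same `R` serves
-- for all pairs of corresponding intervals, which is how `Iso⇒≈` descends.
record Iso (S T : Part d ℓ) : Set (L.suc ℓ) where
  field
    R         : ∣ S ∣ → ∣ T ∣ → Set ℓ
    to        : ∀ x → S ∋ x → ∃[ y ] (T ∋ y × R x y)
    from      : ∀ y → T ∋ y → ∃[ x ] (S ∋ x × R x y)
    colours   : ∀ {x y} → R x y → colour S x ≡ colour T y
    to-mono   : ∀ {x x′ y y′} → R x y → R x′ y′ → x <[ S ] x′ → y <[ T ] y′
    from-mono : ∀ {x x′ y y′} → R x y → R x′ y′ → y <[ T ] y′ → x <[ S ] x′

open Iso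

Iso-sym : {S T : Part d ℓ} → Iso S T → Iso T S
Iso-sym i = record
  { R = flip (R i) ; to = from i ; from = to i ; colours = sym ∘ colours i
  ; to-mono = from-mono i ; from-mono = to-mono i }

Iso⇒≈ : ∀ q {S T : Part d ℓ} → Iso S T → S ≈[ q ] T
Iso⇒≈ zero _ = tt
Iso⇒≈ {d = d} {ℓ} (suc q) {S} {T} i = ≼ i , ≼ (Iso-sym i)
  where
  module _ {S T : Part d ℓ} (i : Iso S T) {x y} (r : R i x y) where
    left : Iso (S ↓ x) (T ↓ y)
    left = record
      { R         = R i
      ; to        = λ z (z∈S , z<x) → let w , w∈T , s = to i z z∈S in w , (w∈T , to-mono i s r z<x) , s
      ; from      = λ w (w∈T , w<y) → let z , z∈S , s = from i w w∈T in z , (z∈S , from-mono i s r w<y) , s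
      ; colours   = colours i
      ; to-mono   = to-mono i
      ; from-mono = from-mono i
      }
    right : Iso (S ↑ x) (T ↑ y)
    right = record
      { R         = R i
      ; to        = λ z (z∈S , x<z) → let w , w∈T , s = to i z z∈S in w , (w∈T , to-mono i r s x<z) , s
      ; from      = λ w (w∈T , y<w) → let z , z∈S , s = from i w w∈T in z , (z∈S , from-mono i r s y<w) , s
      ; colours   = colours i
      ; to-mono   = to-mono i
      ; from-mono = from-mono i
      }
  ≼ : {S T : Part d ℓ} → Iso S T → S ≼[ q ] T
  ≼ i x x∈S = let y , y∈T , r = to i x x∈S in
    y , y∈T , colours i r , Iso⇒≈ q (left i r) , Iso⇒≈ q (right i r)

≈-ext : ∀ q {X : Chain d ℓ} {P Q : Pred (Chain.Carrier X) ℓ} →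
        (∀ {x} → P x → Q x) → (∀ {x} → Q x → P x) → X ↾ P ≈[ q ] X ↾ Q
≈-ext q P⊆Q Q⊆P = Iso⇒≈ q record
  { R = _≡_
  ; to        = λ x x∈P → x , P⊆Q x∈P , refl
  ; from      = λ x x∈Q → x , Q⊆P x∈Q , refl
  ; colours   = λ { refl → refl }
  ; to-mono   = λ { refl refl → id }
  ; from-mono = λ { refl refl → id }
  }

≈-empty : ∀ q {S T : Part d ℓ} → (∀ x → ¬ S ∋ x) → (∀ y → ¬ T ∋ y) → S ≈[ q ] T
≈-empty zero    _ _ = tt
≈-empty (suc q) S∅ T∅ = (λ x x∈S → ⊥-elim (S∅ x x∈S)) , (λ y y∈T → ⊥-elim (T∅ y y∈T))

Cut : (S : Part d ℓ) → Pred ∣ S ∣ ℓ → Set ℓ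
Cut S P = ∀ {x y} → S ∋ x → S ∋ y → P x → ¬ P y → x <[ S ] y


-- A position of the game: the chosen pairs sit at the nodes of a search tree,
-- the intervals still in play at its leaves.

data Play (q : ℕ) {d ℓ} : Part d ℓ → Part d ℓ → Set (L.suc ℓ) where
  leaf : ∀ {S T} → S ≈[ q ] T → Play q S T
  node : ∀ {S T x y} → S ∋ x → T ∋ y → colour S x ≡ colour T y →
         Play q (S ↓ x) (T ↓ y) → Play q (S ↑ x) (T ↑ y) → Play q S T

data Chosen {q d ℓ} : {S T : Part d ℓ} → Play q S T → ∣ S ∣ → ∣ T ∣ → Set (L.suc ℓ) where
  here  : ∀ {S T x y x∈S y∈T c l r} → Chosen {S = S} {T} (node {x = x} {y} x∈S y∈T c l r) x y
  left  : ∀ {S T x y x∈S y∈T c l r u v} → Chosen l u v →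
          Chosen {S = S} {T} (node {x = x} {y} x∈S y∈T c l r) u v
  right : ∀ {S T x y x∈S y∈T c l r u v} → Chosen r u v →
          Chosen {S = S} {T} (node {x = x} {y} x∈S y∈T c l r) u v

Chosen-∈ : ∀ {q} {S T : Part d ℓ} {π : Play q S T} {x y} → Chosen π x y →
           S ∋ x × T ∋ y × colour S x ≡ colour T y
Chosen-∈ (here {x∈S = x∈S} {y∈T} {c}) = x∈S , y∈T , c
Chosen-∈ (left p)  = let (a , _) , (b , _) , c = Chosen-∈ p in a , b , c
Chosen-∈ (right p) = let (a , _) , (b , _) , c = Chosen-∈ p in a , b , c

data SameOrder (S T : Part d ℓ) (x x′ : ∣ S ∣) (y y′ : ∣ T ∣) : Set ℓ where
  equal   : x ≡ x′ → y ≡ y′ → SameOrder S T x x′ y y′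
  lesser  : x <[ S ] x′ → y <[ T ] y′ → SameOrder S T x x′ y y′
  greater : x′ <[ S ] x → y′ <[ T ] y → SameOrder S T x x′ y y′

module _ {S T : Part d ℓ} where
  private
    module S = Chain (chain S)
    module T = Chain (chain T)

  SameOrder-≡ : ∀ {x x′ y y′} → SameOrder S T x x′ y y′ → (x ≡ x′) ⇔ (y ≡ y′)
  SameOrder-≡ (equal p q) = mk⇔ (λ _ → q) (λ _ → p)
  SameOrder-≡ (lesser p q) = mk⇔ (λ e → ⊥-elim (S.irrefl e p)) (λ e → ⊥-elim (T.irrefl e q))
  SameOrder-≡ (greater p q) = mk⇔ (λ e → ⊥-elim (S.irrefl (sym e) p)) (λ e → ⊥-elim (T.irrefl (sym e) q))

  SameOrder-< : ∀ {x x′ y y′} → SameOrder S T x x′ y y′ → (x <[ S ] x′) ⇔ (y <[ T ] y′)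
  SameOrder-< (equal p q) = mk⇔ (λ l → ⊥-elim (S.irrefl p l)) (λ l → ⊥-elim (T.irrefl q l))
  SameOrder-< (lesser p q) = mk⇔ (λ _ → q) (λ _ → p)
  SameOrder-< (greater p q) = mk⇔ (λ l → ⊥-elim (S.asym l p)) (λ l → ⊥-elim (T.asym l q))

  restrict-SameOrder : ∀ {P Q x x′ y y′} → SameOrder (S ∩ P) (T ∩ Q) x x′ y y′ → SameOrder S T x x′ y y′
  restrict-SameOrder (equal p q) = equal p q
  restrict-SameOrder (lesser p q) = lesser p q
  restrict-SameOrder (greater p q) = greater p q

-- Pairs on different sides of a node are separated, in both chains, by the pair at that node.
Chosen-order : ∀ {q} {S T : Part d ℓ} {π : Play q S T} {x x′ y y′} →
               Chosen π x y → Chosen π x′ y′ → SameOrder S T x x′ y y′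
Chosen-order here here = equal refl refl
Chosen-order here (left p) = let (_ , a) , (_ , b) , _ = Chosen-∈ p in greater a b
Chosen-order here (right p) = let (_ , a) , (_ , b) , _ = Chosen-∈ p in lesser a b
Chosen-order (left p) here = let (_ , a) , (_ , b) , _ = Chosen-∈ p in lesser a b
Chosen-order (left p) (left p′) = restrict-SameOrder (Chosen-order p p′)
Chosen-order {S = S} {T} (left p) (right p′) =
  let (_ , a) , (_ , b) , _ = Chosen-∈ p
      (_ , a′) , (_ , b′) , _ = Chosen-∈ p′
  in lesser (Chain.<-trans (chain S) a a′) (Chain.<-trans (chain T) b b′)
Chosen-order (right p) here = let (_ , a) , (_ , b) , _ = Chosen-∈ p in greater a b
Chosen-order {S = S} {T} (right p) (left p′) =
  let (_ , a) , (_ , b) , _ = Chosen-∈ p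
      (_ , a′) , (_ , b′) , _ = Chosen-∈ p′
  in greater (Chain.<-trans (chain S) a′ a) (Chain.<-trans (chain T) b′ b)
Chosen-order (right p) (right p′) = restrict-SameOrder (Chosen-order p p′)

Play-weaken : ∀ {q} {S T : Part d ℓ} (π : Play (suc q) S T) →
  Σ[ π′ ∈ Play q S T ] (∀ {x y} → Chosen π x y → Chosen π′ x y)
Play-weaken (leaf e) = leaf (≈-weaken _ e) , λ ()
Play-weaken (node x∈S y∈T c l r) =
  let l′ , f = Play-weaken l ; r′ , g = Play-weaken r
  in node x∈S y∈T c l′ r′ , λ { here → here ; (left p) → left (f p) ; (right p) → right (g p) }

Play-sym : ∀ {q} {S T : Part d ℓ} (π : Play q S T) →
  Σ[ π′ ∈ Play q T S ] ((∀ {x y} → Chosen π x y → Chosen π′ y x) × (∀ {x y} → Chosen π′ y x → Chosen π x y))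
Play-sym (leaf e) = leaf (≈-sym _ e) , (λ ()) , λ ()
Play-sym (node x∈S y∈T c l r) =
  let l′ , f , f′ = Play-sym l ; r′ , g , g′ = Play-sym r
  in node y∈T x∈S (sym c) l′ r′
   , (λ { here → here ; (left p) → left (f p) ; (right p) → right (g p) })
   , (λ { here → here ; (left p) → left (f′ p) ; (right p) → right (g′ p) })

-- The new point is searched for in the tree. At a leaf, `≈[ suc q ]` supplies the answer; a point
-- met at a node is answered by its old partner. Everything off the search path merely loses a
-- round.
Play-forth : ∀ {q} {S T : Part d ℓ} (π : Play (suc q) S T) {x} → S ∋ x →
  ∃[ y ] Σ[ π′ ∈ Play q S T ] (Chosen π′ x y × (∀ {u v} → Chosen π u v → Chosen π′ u v))
Play-forth (leaf (f , _)) x∈S =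
  let y , y∈T , c , l , r = f _ x∈S in y , node x∈S y∈T c (leaf l) (leaf r) , here , λ ()
Play-forth {S = S} (node {x = z} z∈S w∈T c l r) {x} x∈S with Chain.compare (chain S) x z
... | tri< x<z _ _ =
  let y , l′ , x∈l′ , f = Play-forth l (x∈S , x<z) ; r′ , g = Play-weaken r
  in y , node z∈S w∈T c l′ r′ , left x∈l′
   , λ { here → here ; (left p) → left (f p) ; (right p) → right (g p) }
... | tri≈ _ refl _ =
  let π′ , f = Play-weaken (node z∈S w∈T c l r) in _ , π′ , f here , f
... | tri> _ _ z<x =
  let y , r′ , x∈r′ , g = Play-forth r (x∈S , z<x) ; l′ , f = Play-weaken l
  in y , node z∈S w∈T c l′ r′ , right x∈r′
   , λ { here → here ; (left p) → left (f p) ; (right p) → right (g p) }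

Play-back : ∀ {q} {S T : Part d ℓ} (π : Play (suc q) S T) {y} → T ∋ y →
  ∃[ x ] Σ[ π′ ∈ Play q S T ] (Chosen π′ x y × (∀ {u v} → Chosen π u v → Chosen π′ u v))
Play-back π y∈T =
  let ϖ , f , _ = Play-sym π
      x , ϖ′ , p , g = Play-forth ϖ y∈T
      π′ , h , _ = Play-sym ϖ′
  in x , π′ , h p , λ q → h (g (f q))

-- From the game to first-order sentences

module _ {α : Ordinal ℓ} (𝔄 : ColoredOrdinal d α) where
  open Ordinal α
  open ColoredOrdinal 𝔄

  ⟪_⟫ : Chain d ℓ
  ⟪_⟫ = record
    { Carrier            = Carrier
    ; _<_                = _<_
    ; isStrictTotalOrder = isStrictTotalOrder
    ; colour             = λ x → proj₁ (partition x)
    }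

  Color⇒colour : ∀ {i x} → Color i x → Chain.colour ⟪_⟫ x ≡ i
  Color⇒colour {x = x} c = proj₂ (proj₂ (partition x)) c

  colour⇒Color : ∀ {i x} → Chain.colour ⟪_⟫ x ≡ i → Color i x
  colour⇒Color {x = x} refl = proj₁ (proj₂ (partition x))

Whole : Chain d ℓ → Part d ℓ
Whole X = X ↾ λ _ → ⊤

module _ {α β : Ordinal ℓ} (𝔄 : ColoredOrdinal d α) (𝔅 : ColoredOrdinal d β) where

  private
    S = Whole ⟪ 𝔄 ⟫
    T = Whole ⟪ 𝔅 ⟫

  open Equivalence

  Play⇒Satisfies : ∀ {q n} (π : Play q S T) (ρ : Vec ∣ S ∣ n) (σ : Vec ∣ T ∣ n) →
    (∀ i → Chosen π (lookup ρ i) (lookup σ i)) →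
    ∀ φ → quantifierRank φ ≤ q → Satisfies 𝔄 ρ φ ⇔ Satisfies 𝔅 σ φ
  Play⇒Satisfies π ρ σ m (x ≐ y) _ = SameOrder-≡ (Chosen-order (m x) (m y))
  Play⇒Satisfies π ρ σ m (x ≺ y) _ = SameOrder-< (Chosen-order (m x) (m y))
  Play⇒Satisfies π ρ σ m (color i x) _ =
    let _ , _ , c = Chosen-∈ (m x)
    in mk⇔ (λ a → colour⇒Color 𝔅 (trans (sym c) (Color⇒colour 𝔄 a)))
           (λ a → colour⇒Color 𝔄 (trans c (Color⇒colour 𝔅 a)))
  Play⇒Satisfies π ρ σ m (~ φ) le =
    let e = Play⇒Satisfies π ρ σ m φ le in mk⇔ (λ f a → f (from e a)) (λ f a → f (to e a))
  Play⇒Satisfies π ρ σ m (φ ∧ ψ) le =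
    let e = Play⇒Satisfies π ρ σ m φ (ℕ.m⊔n≤o⇒m≤o _ _ le)
        e′ = Play⇒Satisfies π ρ σ m ψ (ℕ.m⊔n≤o⇒n≤o _ _ le)
    in mk⇔ (λ (a , b) → to e a , to e′ b) (λ (a , b) → from e a , from e′ b)
  Play⇒Satisfies π ρ σ m (φ ∨ ψ) le =
    let e = Play⇒Satisfies π ρ σ m φ (ℕ.m⊔n≤o⇒m≤o _ _ le)
        e′ = Play⇒Satisfies π ρ σ m ψ (ℕ.m⊔n≤o⇒n≤o _ _ le)
    in mk⇔ [ inj₁ ∘ to e , inj₂ ∘ to e′ ] [ inj₁ ∘ from e , inj₂ ∘ from e′ ]
  Play⇒Satisfies π ρ σ m (φ ⇒ ψ) le =
    let e = Play⇒Satisfies π ρ σ m φ (ℕ.m⊔n≤o⇒m≤o _ _ le)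
        e′ = Play⇒Satisfies π ρ σ m ψ (ℕ.m⊔n≤o⇒n≤o _ _ le)
    in mk⇔ (λ f a → to e′ (f (from e a))) (λ f a → from e′ (f (to e a)))
  Play⇒Satisfies π ρ σ m (all φ) (s≤s le) = mk⇔
    (λ f b → let a , π′ , p , k = Play-back π {b} tt in
      to (Play⇒Satisfies π′ (a ∷ ρ) (b ∷ σ) (λ { fzero → p ; (fsuc i) → k (m i) }) φ le) (f a))
    (λ f a → let b , π′ , p , k = Play-forth π {a} tt in
      from (Play⇒Satisfies π′ (a ∷ ρ) (b ∷ σ) (λ { fzero → p ; (fsuc i) → k (m i) }) φ le) (f b))
  Play⇒Satisfies π ρ σ m (ex φ) (s≤s le) = mk⇔
    (λ (a , s) → let b , π′ , p , k = Play-forth π {a} tt in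
      b , to (Play⇒Satisfies π′ (a ∷ ρ) (b ∷ σ) (λ { fzero → p ; (fsuc i) → k (m i) }) φ le) s)
    (λ (b , s) → let a , π′ , p , k = Play-back π {b} tt in
      a , from (Play⇒Satisfies π′ (a ∷ ρ) (b ∷ σ) (λ { fzero → p ; (fsuc i) → k (m i) }) φ le) s)

  ≈⇒≡ : ∀ q → S ≈[ q ] T → 𝔄 ≡[ q ] 𝔅
  ≈⇒≡ q e φ = Play⇒Satisfies (leaf e) [] [] (λ ()) φ

-- Countable Skolem hulls

Countable : ∀ {X : Set ℓ} → Pred X ℓ → Set ℓ
Countable {X = X} P = Σ[ e ∈ (X → ℕ) ] (∀ {x y} → P x → P y → e x ≡ e y → x ≡ y)

-- A variant of Cantor's pairing, injective but not onto. With `s = a + b` the value lies between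
-- `s * s` and `s * s + s`; these ranges are disjoint for different `s`, so `s` and then `a` can be
-- read off.
pair : ℕ → ℕ → ℕ
pair a b = (a ℕ.+ b) ℕ.* (a ℕ.+ b) ℕ.+ a

pair-< : ∀ a b a′ b′ → a ℕ.+ b ℕ.< a′ ℕ.+ b′ → pair a b ℕ.< pair a′ b′
pair-< a b a′ b′ s<s′ = begin-strict
  s ℕ.* s ℕ.+ a          ≤⟨ ℕ.+-monoʳ-≤ (s ℕ.* s) (ℕ.m≤m+n a b) ⟩
  s ℕ.* s ℕ.+ s          ≡⟨ ℕ.+-comm (s ℕ.* s) s ⟩
  suc s ℕ.* s            <⟨ ℕ.*-monoʳ-< (suc s) (ℕ.n<1+n s) ⟩
  suc s ℕ.* suc s        ≤⟨ ℕ.*-mono-≤ s<s′ s<s′ ⟩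
  s′ ℕ.* s′              ≤⟨ ℕ.m≤m+n _ a′ ⟩
  s′ ℕ.* s′ ℕ.+ a′       ∎
  where
  open ℕ.≤-Reasoning
  s = a ℕ.+ b
  s′ = a′ ℕ.+ b′

pair-injective : ∀ a b a′ b′ → pair a b ≡ pair a′ b′ → a ≡ a′ × b ≡ b′
pair-injective a b a′ b′ e with ℕ.<-cmp (a ℕ.+ b) (a′ ℕ.+ b′)
... | tri< l _ _ = ⊥-elim (ℕ.<-irrefl e (pair-< a b a′ b′ l))
... | tri> _ _ g = ⊥-elim (ℕ.<-irrefl (sym e) (pair-< a′ b′ a b g))
... | tri≈ _ s≡s′ _ = a≡a′ , ℕ.+-cancelˡ-≡ a b b′ (trans s≡s′ (cong (ℕ._+ b′) (sym a≡a′)))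
  where
  a≡a′ : a ≡ a′
  a≡a′ = ℕ.+-cancelˡ-≡ ((a ℕ.+ b) ℕ.* (a ℕ.+ b)) a a′ (trans e (cong (λ s → s ℕ.* s ℕ.+ a′) (sym s≡s′)))

-- Names for the points of a Skolem hull: node n l u is a point of profile n
-- strictly between l and u, and end stands for either infinite bound.

data Name : Set where
  end  : Name
  node : ℕ → Name → Name → Name

encode : Name → ℕ
encode end          = 0
encode (node n l u) = suc (pair n (pair (encode l) (encode u)))

encode-injective : ∀ s t → encode s ≡ encode t → s ≡ t
encode-injective end          end             _ = refl
encode-injective (node n l u) (node n′ l′ u′) e
  with refl , e′ ← pair-injective n _ n′ _ (ℕ.suc-injective e)
  with el , eu ← pair-injective (encode l) _ (encode l′) _ e′
  with refl ← encode-injective l l′ el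
  with refl ← encode-injective u u′ eu = refl

-- Index orders, lexicographic products and ranks

ω : ∀ ℓ → Ordinal ℓ
ω ℓ = record
  { Carrier            = Lift ℓ ℕ
  ; _<_                = λ i j → Lift ℓ (lower i ℕ.< lower j)
  ; isStrictTotalOrder = isStrictTotalOrderᶜ record
    { isEquivalence = isEquivalence
    ; trans         = λ (lift p) (lift q) → lift (ℕ.<-trans p q)
    ; compare       = ω-compare
    }
  ; wellFounded        = λ (lift n) → ω-acc (ℕ-wellFounded n)
  ; <-irrelevant       = λ (lift p) (lift q) → cong lift (ℕ.<-irrelevant p q)
  }
  where
  _≺ω_ : Rel (Lift ℓ ℕ) ℓ
  i ≺ω j = Lift ℓ (lower i ℕ.< lower j)
  ω-compare : Trichotomous _≡_ _≺ω_
  ω-compare (lift m) (lift n) with ℕ.<-cmp m n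
  ... | tri< a b c = tri< (lift a) (λ { refl → b refl }) (c ∘ lower)
  ... | tri≈ a b c = tri≈ (a ∘ lower) (cong lift b) (c ∘ lower)
  ... | tri> a b c = tri> (a ∘ lower) (λ { refl → b refl }) (lift c)
  ω-acc : ∀ {n} → Acc ℕ._<_ n → Acc _≺ω_ (lift n)
  ω-acc (acc rs) = acc λ (lift p) → ω-acc (rs p)

-- The index in `κ` is compared first, so this is `κ` copies of `X` in a row, the product `X · κ`.
lexicographic : (κ : Ordinal ℓ) → Chain d ℓ → Chain d ℓ
lexicographic {ℓ = ℓ} κ X = record
  { Carrier            = κ.Carrier × X.Carrier
  ; _<_                = _<ₗ_
  ; isStrictTotalOrder = isStrictTotalOrderᶜ record
    { isEquivalence = isEquivalence
    ; trans         = <ₗ-trans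
    ; compare       = <ₗ-compare
    }
  ; colour             = X.colour ∘ proj₂
  }
  where
  module κ where
    open Ordinal κ public
    open IsStrictTotalOrder isStrictTotalOrder public
  module X = Chain X
  _<ₗ_ : Rel (κ.Carrier × X.Carrier) ℓ
  _<ₗ_ = ×-Lex _≡_ κ._<_ X._<_
  <ₗ-trans : ∀ {u v w} → u <ₗ v → v <ₗ w → u <ₗ w
  <ₗ-trans (inj₁ p)          (inj₁ q)          = inj₁ (κ.trans p q)
  <ₗ-trans (inj₁ p)          (inj₂ (refl , _)) = inj₁ p
  <ₗ-trans (inj₂ (refl , _)) (inj₁ q)          = inj₁ q
  <ₗ-trans (inj₂ (refl , p)) (inj₂ (refl , q)) = inj₂ (refl , X.<-trans p q)
  <ₗ-compare : Trichotomous _≡_ _<ₗ_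
  <ₗ-compare (i , x) (j , y) with κ.compare i j
  ... | tri< i<j i≢j j≮i = tri< (inj₁ i<j) (i≢j ∘ ,-injectiveˡ) [ j≮i , i≢j ∘ sym ∘ proj₁ ]
  ... | tri> i≮j i≢j j<i = tri> [ i≮j , i≢j ∘ proj₁ ] (i≢j ∘ ,-injectiveˡ) (inj₁ j<i)
  ... | tri≈ i≮i refl _ with X.compare x y
  ...   | tri< x<y x≢y y≮x = tri< (inj₂ (refl , x<y)) (λ { refl → x≢y refl }) [ i≮i , y≮x ∘ proj₂ ]
  ...   | tri≈ x≮y refl y≮x = tri≈ [ i≮i , x≮y ∘ proj₂ ] refl [ i≮i , y≮x ∘ proj₂ ]
  ...   | tri> x≮y x≢y y<x = tri> [ i≮i , x≮y ∘ proj₂ ] (λ { refl → x≢y refl }) (inj₂ (refl , y<x))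

-- Rank S κ x v: the elements of S below x have order type v.

data Rank (S : Part d ℓ) (κ : Ordinal ℓ) : ∣ S ∣ → Ordinal.Carrier κ → Set ℓ where
  rank : ∀ {x v} →
    (∀ {y} → S ∋ y → y <[ S ] x → ∃[ u ] (Ordinal._<_ κ u v × Rank S κ y u)) →
    (∀ {u} → Ordinal._<_ κ u v → ∃[ y ] (S ∋ y × y <[ S ] x × Rank S κ y u)) →
    Rank S κ x v

-- Finitely many types, and ordered sums

module _ (em : ∀ {a} → ExcludedMiddle a) where

  -- A code is the set of realised profiles as a number, so that finitely many
  -- codes determine ≈[ q ].

  codes : ℕ → ℕ → ℕ
  codes d zero    = 1
  codes d (suc q) = 2 ℕ.^ (d ℕ.* (codes d q ℕ.* codes d q))

  code    : ∀ q → Part d ℓ → Fin (codes d q)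
  profile : ∀ q (S : Part d ℓ) → ∣ S ∣ → Fin (d ℕ.* (codes d q ℕ.* codes d q))

  code zero    S = fzero
  code (suc q) S = funToFin λ t →
    if does (em {P = ∃[ x ] (S ∋ x × profile q S x ≡ t)}) then fsuc fzero else fzero

  profile q S x = combine (colour S x) (combine (code q (S ↓ x)) (code q (S ↑ x)))

  profile-injective : ∀ q (S T : Part d ℓ) {x y} → profile q S x ≡ profile q T y →
    colour S x ≡ colour T y × code q (S ↓ x) ≡ code q (T ↓ y) × code q (S ↑ x) ≡ code q (T ↑ y)
  profile-injective q S T {x} {y} e =
    let c , e′ = combine-injective (colour S x) _ (colour T y) _ e
    in c , combine-injective (code q (S ↓ x)) _ (code q (T ↓ y)) _ e′

  code-≈ : ∀ q {S T : Part d ℓ} → code q S ≡ code q T → S ≈[ q ] T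
  code-≈ zero _ = tt
  code-≈ {d = d} {ℓ} (suc q) {S} {T} e = ≼ e , ≼ (sym e)
    where
    ≼ : {S T : Part d ℓ} → code (suc q) S ≡ code (suc q) T → S ≼[ q ] T
    -- Decoding both codes at the profile of `x` equates two bits. The bit of `S` is one, since `x`
    -- itself realises the profile, so the bit of `T` is one too and provides the answer.
    ≼ {S} {T} e x x∈S with em {P = ∃[ x′ ] (S ∋ x′ × profile q S x′ ≡ profile q S x)}
                         | em {P = ∃[ y ] (T ∋ y × profile q T y ≡ profile q S x)}
                         | trans (sym (finToFun-funToFin _ (profile q S x)))
                             (trans (cong (λ f → finToFun f (profile q S x)) e)
                               (finToFun-funToFin _ (profile q S x)))
    ... | no ¬x | _ | _ = ⊥-elim (¬x (x , x∈S , refl))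
    ... | yes _ | yes (y , y∈T , e′) | _ =
      let c , l , r = profile-injective q S T (sym e′)
      in y , y∈T , c , code-≈ q l , code-≈ q r

  -- The composition lemma for ordered sums. A move lies in one summand and is answered there; the
  -- other summand passes whole into one of the two new intervals and only loses a round.
  ≈-sum : ∀ q {S T : Part d ℓ} {P Q} → Cut S P → Cut T Q →
          S ∩ P ≈[ q ] T ∩ Q → S ∩ (¬_ ∘ P) ≈[ q ] T ∩ (¬_ ∘ Q) → S ≈[ q ] T
  ≈-sum zero _ _ _ _ = tt
  ≈-sum {d = d} {ℓ} (suc q) {S} {T} {P} {Q} cutS cutT l r =
    ≼ {S} {T} {P} {Q} cutS cutT l r ,
    ≼ {T} {S} {Q} {P} cutT cutS (swap l) (swap r)
    where
    ≼ : {S T : Part d ℓ} {P : Pred ∣ S ∣ ℓ} {Q : Pred ∣ T ∣ ℓ} → Cut S P → Cut T Q →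
        S ∩ P ≈[ suc q ] T ∩ Q → S ∩ (¬_ ∘ P) ≈[ suc q ] T ∩ (¬_ ∘ Q) → S ≼[ q ] T
    ≼ {S} {T} {P} {Q} cutS cutT l r x x∈S with em {P = P x}
    ... | yes x∈P =
      let y , (y∈T , y∈Q) , c , ll , lr = proj₁ l x (x∈S , x∈P)
      in y , y∈T , c
       , ≈-trans q (below cutS x∈S x∈P) (≈-trans q ll (≈-sym q (below cutT y∈T y∈Q)))
       , ≈-sum q {P = P} {Q} (λ (a , _) (b , _) → cutS a b) (λ (a , _) (b , _) → cutT a b)
           (≈-trans q (≈-ext q (λ ((a , b) , c) → (a , c) , b) (λ ((a , b) , c) → (a , c) , b))
             (≈-trans q lr (≈-ext q (λ ((a , b) , c) → (a , c) , b) (λ ((a , b) , c) → (a , c) , b))))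
           (≈-trans q (≈-ext q (λ ((a , _) , c) → a , c) (λ (a , c) → (a , cutS x∈S a x∈P c) , c))
             (≈-trans q (≈-weaken q r)
               (≈-ext q (λ (a , c) → (a , cutT y∈T a y∈Q c) , c) (λ ((a , _) , c) → a , c))))
      where
      below : ∀ {S : Part d ℓ} {P} → Cut S P → ∀ {x} → S ∋ x → P x → S ↓ x ≈[ q ] (S ∩ P) ↓ x
      below {S} {P} cut {x} x∈S x∈P = ≈-ext q
        (λ {z} (z∈S , z<x) → (z∈S , decidable-stable em λ z∉P → Chain.asym (chain S) z<x (cut x∈S z∈S x∈P z∉P)) , z<x)
        (λ ((a , _) , c) → a , c)
    ... | no x∉P =
      let y , (y∈T , y∉Q) , c , rl , rr = proj₁ r x (x∈S , x∉P)
      in y , y∈T , c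
       , ≈-sum q {P = P} {Q} (λ (a , _) (b , _) → cutS a b) (λ (a , _) (b , _) → cutT a b)
           (≈-trans q (≈-ext q (λ ((a , _) , c) → a , c) (λ (a , c) → (a , cutS a x∈S c x∉P) , c))
             (≈-trans q (≈-weaken q l)
               (≈-ext q (λ (a , c) → (a , cutT a y∈T c y∉Q) , c) (λ ((a , _) , c) → a , c))))
           (≈-trans q (≈-ext q (λ ((a , b) , c) → (a , c) , b) (λ ((a , b) , c) → (a , c) , b))
             (≈-trans q rl (≈-ext q (λ ((a , b) , c) → (a , c) , b) (λ ((a , b) , c) → (a , c) , b))))
       , ≈-trans q (above cutS x∈S x∉P) (≈-trans q rr (≈-sym q (above cutT y∈T y∉Q)))
      where
      above : ∀ {S : Part d ℓ} {P} → Cut S P → ∀ {x} → S ∋ x → ¬ P x → S ↑ x ≈[ q ] (S ∩ (¬_ ∘ P)) ↑ x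
      above {S} cut {x} x∈S x∉P = ≈-ext q
        (λ {z} (z∈S , x<z) → (z∈S , λ z∈P → Chain.asym (chain S) x<z (cut z∈S x∈S z∈P x∉P)) , x<z)
        (λ ((a , _) , c) → a , c)

  Countable-∪ : ∀ {X : Set ℓ} {P Q : Pred X ℓ} → Countable P → Countable Q → Countable (λ x → P x ⊎ Q x)
  Countable-∪ {X = X} {P} {Q} (e , e-inj) (f , f-inj) = g , λ x∈ y∈ → g-inj x∈ y∈
    where
    g : X → ℕ
    g x with em {P = P x}
    ... | yes _ = pair 0 (e x)
    ... | no  _ = pair 1 (f x)
    g-inj : ∀ {x y} → P x ⊎ Q x → P y ⊎ Q y → g x ≡ g y → x ≡ y
    g-inj {x} {y} x∈ y∈ eq with em {P = P x} | em {P = P y}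
    ... | yes p | yes p′ = e-inj p p′ (proj₂ (pair-injective 0 _ 0 _ eq))
    ... | yes _ | no _ with () ← proj₁ (pair-injective 0 (e x) 1 (f y) eq)
    ... | no _ | yes _ with () ← proj₁ (pair-injective 1 (f x) 0 (e y) eq)
    ... | no ¬p | no ¬p′ =
      f-inj ([ ⊥-elim ∘ ¬p , id ] x∈) ([ ⊥-elim ∘ ¬p′ , id ] y∈) (proj₂ (pair-injective 1 _ 1 _ eq))

  -- Downward Löwenheim-Skolem for finitely many rounds

  module LöwenheimSkolem (q : ℕ) (S : Part d ℓ) where

    open Chain (chain S) using (_<_; <-trans)

    Above Below : Maybe ∣ S ∣ → Pred ∣ S ∣ ℓ
    Above  nothing  _ = ⊤
    Above  (just a) z = a < z
    Below nothing  _ = ⊤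
    Below (just a) z = z < a

    Above-trans : ∀ l {y z} → Above l y → y < z → Above l z
    Above-trans nothing  _   _   = tt
    Above-trans (just _) l<y y<z = <-trans l<y y<z

    Below-trans : ∀ u {y z} → Below u z → y < z → Below u y
    Below-trans nothing  _   _   = tt
    Below-trans (just _) z<u y<z = <-trans y<z z<u

    Between : Maybe ∣ S ∣ → Maybe ∣ S ∣ → Pred ∣ S ∣ ℓ
    Between l u z = Above l z × Below u z

    Witness : ℕ → Maybe ∣ S ∣ → Maybe ∣ S ∣ → Set ℓ
    Witness n l u = ∃[ x ] (S ∩ Between l u ∋ x × toℕ (profile q (S ∩ Between l u) x) ≡ n)

    -- The decision is an argument so that `witness` can replace `em` by its outcome with `cong`. A
    -- name without a witness has the value `nothing` and then acts as an infinite bound, like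
    -- `end`.
    pick : ∀ n l u → Dec (Witness n l u) → Maybe ∣ S ∣
    pick n l u (yes (x , _)) = just x
    pick n l u (no _)        = nothing

    value : Name → Maybe ∣ S ∣
    value end          = nothing
    value (node n l u) = pick n (value l) (value u) em

    Named : Pred ∣ S ∣ ℓ
    Named x = ∃[ t ] value t ≡ just x

    hull : Part d ℓ
    hull = S ∩ Named

    witness : ∀ s t {x} → let I = S ∩ Between (value s) (value t) in
      I ∋ x → ∃[ y ] (Named y × I ∋ y × profile q I y ≡ profile q I x)
    witness s t {x} x∈ = go em refl
      where
      I = S ∩ Between (value s) (value t)
      n = toℕ (profile q I x)
      go : (w : Dec (Witness n (value s) (value t))) → em ≡ w →
           ∃[ y ] (Named y × I ∋ y × profile q I y ≡ profile q I x)
      go (no ¬w) _ = ⊥-elim (¬w (x , x∈ , refl))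
      go (yes (y , y∈ , e)) eq =
        y , (node n s t , cong (pick n (value s) (value t)) eq) , y∈ , toℕ-injective e

    -- A move in the hull is copied; a move in `S` is answered by a named point of the same profile
    -- in the same interval. Either way the halves have named or infinite ends again. Profiles are
    -- taken at `q` throughout, so that one hull serves every `k ≤ q`.
    hull-between : ∀ k → k ≤ q → ∀ {l u} → ∃[ t ] value t ≡ l → ∃[ t ] value t ≡ u →
                   hull ∩ Between l u ≈[ k ] S ∩ Between l u
    hull-between zero _ _ _ = tt
    hull-between (suc k) k<q {l} {u} l∈ u∈ = forth , back l∈ u∈
      where
      lower-part : ∀ {P : Pred ∣ S ∣ ℓ} {x} → Below u x →
             ((chain S ↾ P) ∩ Between l u) ↓ x ≈[ k ] (chain S ↾ P) ∩ Between l (just x)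
      lower-part x<u = ≈-ext k (λ ((a , b , _) , c) → a , b , c)
                         (λ (a , b , c) → (a , b , Below-trans u x<u c) , c)
      upper-part : ∀ {P : Pred ∣ S ∣ ℓ} {x} → Above l x →
              ((chain S ↾ P) ∩ Between l u) ↑ x ≈[ k ] (chain S ↾ P) ∩ Between (just x) u
      upper-part l<x = ≈-ext k (λ ((a , _ , b) , c) → a , c , b)
                          (λ (a , c , b) → (a , Above-trans l l<x c , b) , c)
      leftᴴ : ∀ {x} → Named x → Below u x → (hull ∩ Between l u) ↓ x ≈[ k ] (S ∩ Between l u) ↓ x
      leftᴴ x∈ x<u = ≈-trans k (lower-part x<u)
        (≈-trans k (hull-between k (ℕ.<⇒≤ k<q) l∈ x∈) (≈-sym k (lower-part x<u)))
      rightᴴ : ∀ {x} → Named x → Above l x → (hull ∩ Between l u) ↑ x ≈[ k ] (S ∩ Between l u) ↑ x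
      rightᴴ x∈ l<x = ≈-trans k (upper-part l<x)
        (≈-trans k (hull-between k (ℕ.<⇒≤ k<q) x∈ u∈) (≈-sym k (upper-part l<x)))
      forth : hull ∩ Between l u ≼[ k ] S ∩ Between l u
      forth x ((x∈S , x∈) , l<x , x<u) = x , (x∈S , l<x , x<u) , refl , leftᴴ x∈ x<u , rightᴴ x∈ l<x
      back : ∃[ t ] value t ≡ l → ∃[ t ] value t ≡ u → S ∩ Between l u ≼[ k ] hull ∩ Between l u
      back (s , refl) (t , refl) x x∈S =
        let y , y∈ , (y∈S , l<y , y<u) , e = witness s t x∈S
            c , el , er = profile-injective q (S ∩ Between l u) (S ∩ Between l u) e
        in y , ((y∈S , y∈) , l<y , y<u) , sym c
         , ≈-weaken-≤ (ℕ.<⇒≤ k<q) (≈-sym q (code-≈ q el)) ⟨∙⟩ ≈-sym k (leftᴴ y∈ y<u)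
         , ≈-weaken-≤ (ℕ.<⇒≤ k<q) (≈-sym q (code-≈ q er)) ⟨∙⟩ ≈-sym k (rightᴴ y∈ l<y)
        where
        infixr 5 _⟨∙⟩_
        _⟨∙⟩_ : ∀ {S T U : Part d ℓ} → S ≈[ k ] T → T ≈[ k ] U → S ≈[ k ] U
        _⟨∙⟩_ = ≈-trans k

    hull-≈ : hull ≈[ q ] S
    hull-≈ = ≈-trans q (≈-ext q (λ x∈ → x∈ , tt , tt) proj₁)
      (≈-trans q (hull-between q ℕ.≤-refl (end , refl) (end , refl)) (≈-ext q proj₁ (λ x∈ → x∈ , tt , tt)))

    hull-countable : Countable (hull ∋_)
    hull-countable = e , λ (_ , s) (_ , t) → e-inj s t
      where
      e : ∣ S ∣ → ℕ
      e x with em {P = Named x}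
      ... | yes (t , _) = encode t
      ... | no _        = 0
      e-inj : ∀ {x y} → Named x → Named y → e x ≡ e y → x ≡ y
      e-inj {x} {y} x∈ y∈ eq with em {P = Named x} | em {P = Named y}
      ... | no x∉ | _ = ⊥-elim (x∉ x∈)
      ... | _ | no y∉ = ⊥-elim (y∉ y∈)
      ... | yes (s , es) | yes (t , et) =
        just-injective (trans (sym es) (trans (cong value (encode-injective s t eq)) et))

  minimal : ∀ {x r p} {X : Set x} {_<_ : Rel X r} → WellFounded _<_ → {P : Pred X p} →
            ∃ P → ∃[ m ] (P m × (∀ {y} → P y → ¬ y < m))
  minimal {X = X} {_<_} wf {P} (a , Pa) = go (wf a) Pa
    where
    go : ∀ {a} → Acc _<_ a → P a → ∃[ m ] (P m × (∀ {y} → P y → ¬ y < m))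
    go {a} (acc rs) Pa with em {P = ∃[ y ] (P y × y < a)}
    ... | yes (y , Py , y<a) = go (rs y<a) Py
    ... | no ¬y = a , Pa , λ Py y<a → ¬y (_ , Py , y<a)

  -- Regular uncountable cardinals

  module WellOrder (κ : Ordinal ℓ) where

    open Ordinal κ public using (Carrier; _<_)
    open IsStrictTotalOrder (Ordinal.isStrictTotalOrder κ) public
      using (compare; asym) renaming (trans to <-trans)

    irrefl : ∀ {x} → ¬ x < x
    irrefl = IsStrictTotalOrder.irrefl (Ordinal.isStrictTotalOrder κ) refl

    ≮-<-trans : ∀ {x y z} → ¬ y < x → y < z → x < z
    ≮-<-trans {x} {y} y≮x y<z with compare x y
    ... | tri< x<y _ _    = <-trans x<y y<z
    ... | tri≈ _ refl _   = y<z
    ... | tri> _ _ y<x    = ⊥-elim (y≮x y<x)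

    <-≮-trans : ∀ {x y z} → x < y → ¬ z < y → x < z
    <-≮-trans {x} {y} {z} x<y z≮y with compare y z
    ... | tri< y<z _ _    = <-trans x<y y<z
    ... | tri≈ _ refl _   = x<y
    ... | tri> _ _ z<y    = ⊥-elim (z≮y z<y)

    least : ∀ {p} {P : Pred Carrier p} → ∃ P → ∃[ m ] (P m × (∀ {x} → P x → ¬ x < m))
    least = minimal (Ordinal.wellFounded κ)

    sequence-mono : ∀ {s : ℕ → Carrier} → (∀ n → s n < s (suc n)) → ∀ {m n} → m ℕ.< n → s m < s n
    sequence-mono {s} step {m} m<n = go (ℕ.<⇒<′ m<n)
      where
      go : ∀ {n} → m ℕ.<′ n → s m < s n
      go ℕ.<′-base = step _
      go (ℕ.<′-step p) = <-trans (go p) (step _)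

    -- An increasing map never goes below the identity: if `m` were least with `h m < m`, then `h m`
    -- would be a smaller such point. A bound `c` would give `h c < c`.
    increasing⇒unbounded : ∀ {h : Carrier → Carrier} → (∀ {a b} → a < b → h a < h b) →
                           ∀ {c} → ¬ (∀ a → h a < c)
    increasing⇒unbounded {h} mono {c} h<c =
      let m , hm<m , least-m = least {P = λ a → h a < a} (c , h<c c)
      in least-m (mono hm<m) hm<m

  module Regular (κ : Ordinal ℓ) (reg : IsRegularUncountableCardinal κ) where

    open WellOrder κ public
    open IsRegularUncountableCardinal reg
    open Ordinal κ using (Below)

    bounded : ∀ a (f : Below a → Carrier) → ∃[ b ] (∀ x → f x < b)
    bounded a f with em {P = ∃[ b ] (∀ x → f x < b)}
    ... | yes b = b
    ... | no ¬b = ⊥-elim (isRegular a f λ b → decidable-stable em λ ¬x →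
      ¬b (b , λ x → decidable-stable em λ fx≮b → ¬x (x , fx≮b)))

    uncountable : ¬ Countable {X = Carrier} (λ _ → ⊤)
    uncountable (e , inj) = isUncountable (mk↣ {to = e} (inj tt tt))

    -- If a greatest `a` has something below it, the constant map `a` on `Below a` contradicts
    -- regularity; if it has nothing below it, there is just one point, against uncountability.
    unbounded : ∀ a → ∃[ b ] a < b
    unbounded a with em {P = ∃[ b ] a < b}
    ... | yes b = b
    ... | no ¬b with em {P = ∃[ x ] x < a}
    ...   | yes x = ⊥-elim (¬b (let b , a<b = bounded a (λ _ → a) in b , a<b x))
    ...   | no ¬x = ⊥-elim (uncountable ((λ _ → 0) , λ {x} {y} _ _ _ → trans (≡a x) (sym (≡a y))))
      where
      ≡a : ∀ x → x ≡ a
      ≡a x with compare x a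
      ... | tri< x<a _ _ = ⊥-elim (¬x (x , x<a))
      ... | tri≈ _ x≡a _ = x≡a
      ... | tri> _ _ a<x = ⊥-elim (¬b (x , a<x))

    inhabitant : Carrier
    inhabitant with em {P = Carrier}
    ... | yes a = a
    ... | no ¬a = ⊥-elim (uncountable ((λ _ → 0) , λ {x} → ⊥-elim (¬a x)))

    above₂ : ∀ a b → ∃[ c ] (a < c × b < c)
    above₂ a b with compare a b
    ... | tri< a<b _ _ = let c , b<c = unbounded b in c , <-trans a<b b<c , b<c
    ... | tri≈ _ refl _ = let c , b<c = unbounded b in c , b<c , b<c
    ... | tri> _ _ b<a = let c , a<c = unbounded a in c , a<c , <-trans b<a a<c

    finite-bounded : ∀ {n} (f : Fin n → Carrier) → ∃[ b ] (∀ i → f i < b)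
    finite-bounded {zero}  f = inhabitant , λ ()
    finite-bounded {suc n} f =
      let b , f<b = finite-bounded (f ∘ fsuc)
          c , f0<c , b<c = above₂ (f fzero) b
      in c , λ { fzero → f0<c ; (fsuc i) → <-trans (f<b i) b<c }

    -- The first ω elements ι n lie below some a, as κ is uncountable; so an
    -- ω-sequence extends to a function on Below a.

    sequence-bounded : ∀ (s : ℕ → Carrier) → ∃[ b ] (∀ n → s n < b)
    sequence-bounded s = b , λ n → subst (_< b) (f-ι n) (f<b (ι n , ι<a n))
      where
      bottom : ∃[ m ] (⊤ {ℓ} × (∀ {x} → ⊤ {ℓ} → ¬ x < m))
      bottom = least {P = λ _ → ⊤} (inhabitant , tt)
      next : ∀ a → ∃[ m ] (a < m × (∀ {x} → a < x → ¬ x < m))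
      next a = least (unbounded a)
      ι : ℕ → Carrier
      ι zero    = proj₁ bottom
      ι (suc n) = proj₁ (next (ι n))
      ι-mono : ∀ {m n} → m ℕ.< n → ι m < ι n
      ι-mono = sequence-mono (λ n → proj₁ (proj₂ (next (ι n))))
      ι-injective : ∀ {m n} → ι m ≡ ι n → m ≡ n
      ι-injective {m} {n} e with ℕ.<-cmp m n
      ... | tri< m<n _ _ = ⊥-elim (irrefl (subst (_< ι n) e (ι-mono m<n)))
      ... | tri≈ _ m≡n _ = m≡n
      ... | tri> _ _ n<m = ⊥-elim (irrefl (subst (ι n <_) e (ι-mono n<m)))
      module _ {x} (x∉ι : ¬ (∃[ n ] ι n ≡ x)) where
        ι-below : ∀ n → ι n < x
        ι-≯     : ∀ n → ¬ x < ι n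
        ι-below n with compare (ι n) x
        ... | tri< ιn<x _ _ = ιn<x
        ... | tri≈ _ ιn≡x _ = ⊥-elim (x∉ι (n , ιn≡x))
        ... | tri> _ _ x<ιn = ⊥-elim (ι-≯ n x<ιn)
        ι-≯ zero    = proj₂ (proj₂ bottom) tt
        ι-≯ (suc n) = proj₂ (proj₂ (next (ι n))) (ι-below n)
      bound-ι : ∃[ a ] (∀ n → ι n < a)
      bound-ι = decidable-stable em λ ¬a →
        let index = λ x → decidable-stable (em {P = ∃[ n ] ι n ≡ x}) (λ x∉ι → ¬a (x , ι-below x∉ι))
        in uncountable (proj₁ ∘ index , λ {x} {y} _ _ e →
             trans (sym (proj₂ (index x))) (trans (cong ι e) (proj₂ (index y))))
      a : Carrier
      a = proj₁ bound-ι
      ι<a : ∀ n → ι n < a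
      ι<a = proj₂ bound-ι
      f : Below a → Carrier
      f (y , _) with em {P = ∃[ n ] ι n ≡ y}
      ... | yes (n , _) = s n
      ... | no _        = inhabitant
      f-ι : ∀ n → f (ι n , ι<a n) ≡ s n
      f-ι n with em {P = ∃[ m ] ι m ≡ ι n}
      ... | yes (m , e) = cong s (ι-injective e)
      ... | no ¬m       = ⊥-elim (¬m (n , refl))
      b : Carrier
      b = proj₁ (bounded a f)
      f<b : ∀ y → f y < b
      f<b = proj₂ (bounded a f)

    countable-bounded : ∀ {P : Pred Carrier ℓ} → Countable P → ∃[ b ] (∀ {x} → P x → x < b)
    countable-bounded {P} (e , e-inj) =
      let b , s<b = sequence-bounded s in b , λ {x} x∈P → subst (_< b) (s-e x∈P) (s<b (e x))
      where
      s : ℕ → Carrier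
      s n with em {P = ∃[ x ] (P x × e x ≡ n)}
      ... | yes (x , _) = x
      ... | no _        = inhabitant
      s-e : ∀ {x} → P x → s (e x) ≡ x
      s-e {x} x∈P with em {P = ∃[ y ] (P y × e y ≡ e x)}
      ... | yes (y , y∈P , eq) = e-inj y∈P x∈P eq
      ... | no ¬y              = ⊥-elim (¬y (x , x∈P , refl))

    supremum : ∀ (s : ℕ → Carrier) →
      ∃[ δ ] ((∀ n → s n < δ) × (∀ {x} → x < δ → ∃[ n ] ¬ s n < x))
    supremum s =
      let δ , s<δ , least-δ = least (sequence-bounded s)
      in δ , s<δ , λ {x} x<δ → decidable-stable em λ ¬n →
           least-δ (λ n → decidable-stable em λ sn≮x → ¬n (n , sn≮x)) x<δ

    -- Here `s (suc n)` bounds `f` on the points below `s n`, and `δ` is the supremum. From `x < δ`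
    -- one gets `x` at most `s n`, hence below `s (suc n)`, so `f x` is caught only by
    -- `s (suc (suc n))`.
    closure-point : ∀ (f : Carrier → Carrier) β → ∃[ δ ] (β < δ × (∀ {x} → x < δ → f x < δ))
    closure-point f β =
      let δ , s<δ , cofinal = supremum s
      in δ , s<δ 0 , λ x<δ →
        let n , sn≮x = cofinal x<δ
        in <-trans (proj₂ (proj₂ (next (s (suc n)))) (≮-<-trans sn≮x (proj₁ (proj₂ (next (s n)))))) (s<δ (suc (suc n)))
      where
      next : ∀ a → ∃[ b ] (a < b × (∀ {x} → x < a → f x < b))
      next a =
        let c , f<c = bounded a (f ∘ proj₁)
            b , a<b , c<b = above₂ a c
        in b , a<b , λ {x} x<a → <-trans (f<c (x , x<a)) c<b
      s : ℕ → Carrier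
      s zero    = β
      s (suc n) = proj₁ (next (s n))

  -- Sums of equivalent blocks

  module Absorption (q : ℕ) (M : Part d ℓ) where

    -- A sum over `I` is described by the index of each point rather than built, so that a segment
    -- of `𝔄` and a lexicographic product are both instances.
    record Blocks (I : Ordinal ℓ) : Set (L.suc ℓ) where
      open Ordinal I
      field
        whole : Part d ℓ
        label : ∣ whole ∣ → Carrier
        mono  : ∀ {x y} → whole ∋ x → whole ∋ y → label x < label y → x <[ whole ] y
        block : ∀ i → whole ∩ (λ x → label x ≡ i) ≈[ q ] M

    module _ {I : Ordinal ℓ} where
      open Ordinal I using (Carrier; _<_)

      infixl 6 _∥_

      _∥_ : Blocks I → Pred Carrier ℓ → Part d ℓ
      B ∥ D = whole ∩ (D ∘ label)
        where open Blocks B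

      Before After : Pred Carrier ℓ → Carrier → Pred Carrier ℓ
      Before D i j = D j × j < i
      After  D i j = D j × i < j

    Agree : ∀ {I J : Ordinal ℓ} (D : Pred (Ordinal.Carrier I) ℓ) (E : Pred (Ordinal.Carrier J) ℓ) →
            Ordinal.Carrier I → Ordinal.Carrier J → Set ℓ
    Agree {I} {J} D E i j = (∃ (Before {I} D i) ⇔ ∃ (Before {J} E j)) × (∃ (After {I} D i) ⇔ ∃ (After {J} E j))

    -- All index orders and all nonempty sets of indices are treated together: a move at index `i`
    -- leaves `Before D i` and `After D i`, and the game compares sums over different index orders.
    AbsorbedUpTo : ℕ → Set (L.suc ℓ)
    AbsorbedUpTo k = ∀ {I : Ordinal ℓ} (B : Blocks I) D → ∃ D → B ∥ D ≈[ k ] M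

    -- A move at `p` cuts block `i` in two. Below `p` come the earlier blocks and then a lower piece
    -- of block `i`; above `p`, an upper piece and then the later blocks. `Low` and `High` mark the
    -- first summand in each case.
    module Split {I : Ordinal ℓ} (B : Blocks I) (D : Pred (Ordinal.Carrier I) ℓ)
                 {p : ∣ Blocks.whole B ∣} (p∈ : B ∥ D ∋ p) where
      open Blocks B
      open WellOrder I

      private
        S = B ∥ D
        i = label p
        p∈W = proj₁ p∈
        module W = Chain (chain whole)

      Low High : Pred ∣ whole ∣ ℓ
      Low  z = label z < i
      High z = label z ≡ i

      ≤-label : ∀ {z} → whole ∋ z → z <[ whole ] p → ¬ i < label z
      ≤-label z∈ z<p i<z = W.asym z<p (mono p∈W z∈ i<z)

      ≥-label : ∀ {z} → whole ∋ z → p <[ whole ] z → ¬ label z < i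
      ≥-label z∈ p<z z<i = W.asym p<z (mono z∈ p∈W z<i)

      low-cut : Cut (S ↓ p) Low
      low-cut ((z∈ , _) , _) ((w∈ , _) , _) z<i w≮i = mono z∈ w∈ (<-≮-trans z<i w≮i)

      high-cut : Cut (S ↑ p) High
      high-cut {z} {w} ((z∈ , _) , _) ((w∈ , _) , p<w) z≡i w≢i with compare (label w) i
      ... | tri< w<i _ _ = ⊥-elim (≥-label w∈ p<w w<i)
      ... | tri≈ _ w≡i _ = ⊥-elim (w≢i w≡i)
      ... | tri> _ _ i<w = mono z∈ w∈ (subst (_< label w) (sym z≡i) i<w)

      before : ∀ k → S ↓ p ∩ Low ≈[ k ] B ∥ Before {I} D i
      before k = ≈-ext k (λ (((z∈ , Dz) , _) , z<i) → z∈ , Dz , z<i)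
                         (λ (z∈ , Dz , z<i) → ((z∈ , Dz) , mono z∈ p∈W z<i) , z<i)

      block-before : ∀ k → S ↓ p ∩ (¬_ ∘ Low) ≈[ k ] whole ∩ (λ z → label z ≡ i) ↓ p
      block-before k = ≈-ext k
        (λ (((z∈ , _) , z<p) , z≮i) → (z∈ , on-label z∈ z<p z≮i) , z<p)
        (λ ((z∈ , z≡i) , z<p) → ((z∈ , subst D (sym z≡i) (proj₂ p∈)) , z<p) , λ z<i → irrefl (subst (_< i) z≡i z<i))
        where
        on-label : ∀ {z} → whole ∋ z → z <[ whole ] p → ¬ label z < i → label z ≡ i
        on-label {z} z∈ z<p z≮i with compare (label z) i
        ... | tri< z<i _ _ = ⊥-elim (z≮i z<i)
        ... | tri≈ _ z≡i _ = z≡i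
        ... | tri> _ _ i<z = ⊥-elim (≤-label z∈ z<p i<z)

      block-after : ∀ k → S ↑ p ∩ High ≈[ k ] whole ∩ (λ z → label z ≡ i) ↑ p
      block-after k = ≈-ext k
        (λ (((z∈ , _) , p<z) , z≡i) → (z∈ , z≡i) , p<z)
        (λ ((z∈ , z≡i) , p<z) → ((z∈ , subst D (sym z≡i) (proj₂ p∈)) , p<z) , z≡i)

      after : ∀ k → S ↑ p ∩ (¬_ ∘ High) ≈[ k ] B ∥ After {I} D i
      after k = ≈-ext k
        (λ (((z∈ , Dz) , p<z) , z≢i) → z∈ , Dz , off-label z∈ p<z z≢i)
        (λ (z∈ , Dz , i<z) → ((z∈ , Dz) , mono p∈W z∈ i<z) , λ z≡i → irrefl (subst (i <_) z≡i i<z))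
        where
        off-label : ∀ {z} → whole ∋ z → p <[ whole ] z → ¬ label z ≡ i → i < label z
        off-label {z} z∈ p<z z≢i with compare (label z) i
        ... | tri< z<i _ _ = ⊥-elim (≥-label z∈ p<z z<i)
        ... | tri≈ _ z≡i _ = ⊥-elim (z≢i z≡i)
        ... | tri> _ _ i<z = i<z

    ∥-respects-∃ : ∀ k → AbsorbedUpTo k → ∀ {I J} (B : Blocks I) (C : Blocks J) D E →
                   ∃ D ⇔ ∃ E → B ∥ D ≈[ k ] C ∥ E
    ∥-respects-∃ k absorbed B C D E D⇔E with em {P = ∃ D}
    ... | yes D≠∅ = ≈-trans k (absorbed B D D≠∅) (≈-sym k (absorbed C E (Equivalence.to D⇔E D≠∅)))
    ... | no ¬D = ≈-empty k (λ x (_ , Dx) → ¬D (_ , Dx)) (λ y (_ , Ey) → ¬D (Equivalence.from D⇔E (_ , Ey)))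

    -- The answer is found in a block with agreeing neighbours, by the `q`-round game between the
    -- two blocks. The sums of whole blocks on either side are empty in both structures or, by
    -- absorption for `k` rounds, like `M` in both.
    step : ∀ k → suc k ≤ q → AbsorbedUpTo k → ∀ {I J} (B : Blocks I) (C : Blocks J) D E →
           (∀ i → D i → ∃[ j ] (E j × Agree {I} {J} D E i j)) → B ∥ D ≼[ k ] C ∥ E
    step k k<q absorbed {I} {J} B C D E match p (p∈ , Dp)
      with j , Ej , before⇔ , after⇔ ← match (Blocks.label B p) Dp
      with r , (r∈ , refl) , c , l , u ← proj₁ (≈-weaken-≤ k<q
             (≈-trans q (Blocks.block B (Blocks.label B p)) (≈-sym q (Blocks.block C j)))) p (p∈ , refl)
      = r , (r∈ , Ej) , c
      , ≈-sum k {P = P.Low} {R.Low} P.low-cut R.low-cut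
          (≈-trans k (P.before k) (≈-trans k (∥-respects-∃ k absorbed B C _ _ before⇔) (≈-sym k (R.before k))))
          (≈-trans k (P.block-before k) (≈-trans k l (≈-sym k (R.block-before k))))
      , ≈-sum k {P = P.High} {R.High} P.high-cut R.high-cut
          (≈-trans k (P.block-after k) (≈-trans k u (≈-sym k (R.block-after k))))
          (≈-trans k (P.after k) (≈-trans k (∥-respects-∃ k absorbed B C _ _ after⇔) (≈-sym k (R.after k))))
      where
      module P = Split B D (p∈ , Dp)
      module R = Split C E (r∈ , Ej)

    -- One round on a sum of blocks only reveals whether the block played in has
    -- predecessors and successors, so 1, 2, 3 or ω blocks already show every
    -- pattern a well-order of blocks can.

    module _ (C : Blocks (ω ℓ)) where

      Initial : ℕ → Pred (Lift ℓ ℕ) ℓ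
      Initial n j = Lift ℓ (lower j ℕ.< n)

      absorb : (∀ n → C ∥ Initial (suc n) ≈[ q ] M) → C ∥ (λ _ → ⊤) ≈[ q ] M →
               ∀ k → k ≤ q → AbsorbedUpTo k
      absorb finite infinite zero _ _ _ _ = tt
      absorb finite infinite (suc k) k<q {I} B D D≠∅ = result
        where
        open WellOrder I
        open Blocks B

        m : Carrier
        m = proj₁ (least D≠∅)
        Dm : D m
        Dm = proj₁ (proj₂ (least D≠∅))
        m-least : ∀ {i} → D i → ¬ i < m
        m-least = proj₂ (proj₂ (least D≠∅))

        both : ∀ {A B : Set ℓ} → A → B → A ⇔ B
        both a b = mk⇔ (λ _ → b) (λ _ → a)
        neither : ∀ {A B : Set ℓ} → ¬ A → ¬ B → A ⇔ B
        neither ¬a ¬b = mk⇔ (⊥-elim ∘ ¬a) (⊥-elim ∘ ¬b)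

        none-before-m : ¬ ∃ (Before {I} D m)
        none-before-m (_ , Di , i<m) = m-least Di i<m

        none-before-0 : ∀ {E} → ¬ ∃ (Before {ω ℓ} E (lift 0))
        none-before-0 (_ , _ , lift ())

        none-after-last : ∀ n → ¬ ∃ (After {ω ℓ} (Initial (suc n)) (lift n))
        none-after-last n (_ , lift j<1+n , lift n<j) = ℕ.<⇒≱ n<j (ℕ.≤-pred j<1+n)

        -- The model sum `C ∥ E` only has to show the same neighbour patterns as `D`; its number of
        -- blocks may differ from that of `B ∥ D`.
        via : ∀ {E} → C ∥ E ≈[ q ] M →
              (∀ i → D i → ∃[ j ] (E j × Agree {I} {ω ℓ} D E i j)) →
              (∀ j → E j → ∃[ i ] (D i × Agree {ω ℓ} {I} E D j i)) → B ∥ D ≈[ suc k ] M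
        via {E} CE≈M D→E E→D = ≈-trans (suc k) {T = C ∥ E}
          (step k k<q IH B C D E D→E , step k k<q IH C B E D E→D) (≈-weaken-≤ k<q CE≈M)
          where
          IH : AbsorbedUpTo k
          IH = absorb finite infinite k (ℕ.<⇒≤ k<q)

        without-last : (∀ i → D i → ∃ (After {I} D i)) → B ∥ D ≈[ suc k ] M
        without-last later = via infinite D→ω ω→D
          where
          D→ω : ∀ i → D i → ∃[ j ] (⊤ × Agree {I} {ω ℓ} D (λ _ → ⊤) i j)
          D→ω i Di with em {P = ∃ (Before {I} D i)}
          ... | yes b = lift 1 , tt , both b (lift 0 , tt , lift (s≤s z≤n)) , both (later i Di) (lift 2 , tt , lift ℕ.≤-refl)
          ... | no ¬b = lift 0 , tt , neither ¬b none-before-0 , both (later i Di) (lift 1 , tt , lift ℕ.≤-refl)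
          ω→D : ∀ j → ⊤ → ∃[ i ] (D i × Agree {ω ℓ} {I} (λ _ → ⊤) D j i)
          ω→D (lift zero) _ = m , Dm , neither none-before-0 none-before-m , both (lift 1 , tt , lift ℕ.≤-refl) (later m Dm)
          ω→D (lift (suc n)) _ = let i , Di , m<i = later m Dm in
            i , Di , both (lift 0 , tt , lift (s≤s z≤n)) (m , Dm , m<i) , both (lift (suc (suc n)) , tt , lift ℕ.≤-refl) (later i Di)

        with-last : ∀ e → D e → (∀ {i} → D i → ¬ e < i) → B ∥ D ≈[ suc k ] M
        with-last e De e-last with compare m e
        ... | tri> _ _ e<m = ⊥-elim (m-least De e<m)
        ... | tri≈ _ refl _ = ≈-trans (suc k)
          (≈-ext (suc k) (λ (z∈ , Dz) → z∈ , only Dz) (λ (z∈ , z≡m) → z∈ , subst D (sym z≡m) Dm))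
          (≈-weaken-≤ k<q (block m))
          where
          only : ∀ {i} → D i → i ≡ m
          only {i} Di with compare i m
          ... | tri< i<m _ _ = ⊥-elim (m-least Di i<m)
          ... | tri≈ _ i≡m _ = i≡m
          ... | tri> _ _ m<i = ⊥-elim (e-last Di m<i)
        ... | tri< m<e _ _ = middle em
          where
          Between : Pred Carrier ℓ
          Between i = D i × m < i × i < e

          none-after-e : ¬ ∃ (After {I} D e)
          none-after-e (_ , Di , e<i) = e-last Di e<i

          position : ∀ i → D i → i ≡ m ⊎ i ≡ e ⊎ Between i
          position i Di with compare m i | compare i e
          ... | tri> _ _ i<m | _ = ⊥-elim (m-least Di i<m)
          ... | tri≈ _ m≡i _ | _ = inj₁ (sym m≡i)
          ... | tri< _ _ _ | tri> _ _ e<i = ⊥-elim (e-last Di e<i)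
          ... | tri< _ _ _ | tri≈ _ i≡e _ = inj₂ (inj₁ i≡e)
          ... | tri< m<i _ _ | tri< i<e _ _ = inj₂ (inj₂ (Di , m<i , i<e))

          middle : Dec (∃ Between) → B ∥ D ≈[ suc k ] M
          -- `finite n` is about `suc n` blocks, so `finite 2` is the model with a first, a middle
          -- and a last one; its middle block answers for every index strictly between `m` and `e`.
          middle (yes (c , Dc , m<c , c<e)) = via (finite 2) D→3 3→D
            where
            D→3 : ∀ i → D i → ∃[ j ] (Initial 3 j × Agree {I} {ω ℓ} D (Initial 3) i j)
            D→3 i Di with position i Di
            ... | inj₁ refl = lift 0 , lift (s≤s z≤n)
              , neither none-before-m none-before-0
              , both (e , De , m<e) (lift 1 , lift (s≤s (s≤s z≤n)) , lift ℕ.≤-refl)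
            ... | inj₂ (inj₁ refl) = lift 2 , lift ℕ.≤-refl
              , both (m , Dm , m<e) (lift 0 , lift (s≤s z≤n) , lift (s≤s z≤n))
              , neither none-after-e (none-after-last 2)
            ... | inj₂ (inj₂ (_ , m<i , i<e)) = lift 1 , lift (s≤s (s≤s z≤n))
              , both (m , Dm , m<i) (lift 0 , lift (s≤s z≤n) , lift ℕ.≤-refl)
              , both (e , De , i<e) (lift 2 , lift ℕ.≤-refl , lift ℕ.≤-refl)
            3→D : ∀ j → Initial 3 j → ∃[ i ] (D i × Agree {ω ℓ} {I} (Initial 3) D j i)
            3→D (lift 0) _ = m , Dm
              , neither none-before-0 none-before-m
              , both (lift 1 , lift (s≤s (s≤s z≤n)) , lift ℕ.≤-refl) (e , De , m<e)
            3→D (lift 1) _ = c , Dc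
              , both (lift 0 , lift (s≤s z≤n) , lift ℕ.≤-refl) (m , Dm , m<c)
              , both (lift 2 , lift ℕ.≤-refl , lift ℕ.≤-refl) (e , De , c<e)
            3→D (lift 2) _ = e , De
              , both (lift 0 , lift (s≤s z≤n) , lift (s≤s z≤n)) (m , Dm , m<e)
              , neither (none-after-last 2) none-after-e
            3→D (lift (suc (suc (suc _)))) (lift (s≤s (s≤s (s≤s ()))))
          middle (no ¬c) = via (finite 1) D→2 2→D
            where
            D→2 : ∀ i → D i → ∃[ j ] (Initial 2 j × Agree {I} {ω ℓ} D (Initial 2) i j)
            D→2 i Di with position i Di
            ... | inj₁ refl = lift 0 , lift (s≤s z≤n)
              , neither none-before-m none-before-0
              , both (e , De , m<e) (lift 1 , lift ℕ.≤-refl , lift ℕ.≤-refl)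
            ... | inj₂ (inj₁ refl) = lift 1 , lift ℕ.≤-refl
              , both (m , Dm , m<e) (lift 0 , lift (s≤s z≤n) , lift ℕ.≤-refl)
              , neither none-after-e (none-after-last 1)
            ... | inj₂ (inj₂ between) = ⊥-elim (¬c (i , between))
            2→D : ∀ j → Initial 2 j → ∃[ i ] (D i × Agree {ω ℓ} {I} (Initial 2) D j i)
            2→D (lift 0) _ = m , Dm
              , neither none-before-0 none-before-m
              , both (lift 1 , lift ℕ.≤-refl , lift ℕ.≤-refl) (e , De , m<e)
            2→D (lift 1) _ = e , De
              , both (lift 0 , lift (s≤s z≤n) , lift ℕ.≤-refl) (m , Dm , m<e)
              , neither (none-after-last 1) none-after-e
            2→D (lift (suc (suc _))) (lift (s≤s (s≤s ())))

        result : B ∥ D ≈[ suc k ] M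
        result with em {P = ∃[ e ] (D e × (∀ {i} → D i → ¬ e < i))}
        ... | yes (e , De , e-last) = with-last e De e-last
        ... | no ¬last = without-last λ i Di → decidable-stable em λ ¬later →
          ¬last (i , Di , λ Dj i<j → ¬later (_ , Dj , i<j))

  -- Tails of a coloured regular cardinal

  module Tails {α : Ordinal ℓ} (reg : IsRegularUncountableCardinal α) (𝔄 : ColoredOrdinal d α) (q : ℕ) where

    open Regular α reg

    A : Part d ℓ
    A = Whole ⟪ 𝔄 ⟫

    From : Carrier → Part d ℓ
    From a = A ∩ λ z → ¬ z < a

    -- A Tarski-Vaught condition on the initial segment below `δ`, with profiles in place of
    -- formulas.
    Closed : Pred Carrier ℓ
    Closed δ = ∀ x z → x < δ → x < z →
      ∃[ z′ ] (x < z′ × z′ < δ × profile q (A ↑ x) z′ ≡ profile q (A ↑ x) z)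

    representatives-bounded : ∀ x → ∃[ b ] (∀ {z} → x < z →
      ∃[ z′ ] (x < z′ × z′ < b × profile q (A ↑ x) z′ ≡ profile q (A ↑ x) z))
    representatives-bounded x = b , λ {z} x<z → representative z x<z
      where
      Realizer : Fin (d ℕ.* (codes d q ℕ.* codes d q)) → Pred Carrier ℓ
      Realizer t z = x < z × profile q (A ↑ x) z ≡ t
      choose : Fin (d ℕ.* (codes d q ℕ.* codes d q)) → Carrier
      choose t with em {P = ∃ (Realizer t)}
      ... | yes (z , _) = z
      ... | no _        = x
      b : Carrier
      b = proj₁ (finite-bounded choose)
      choose-realizes : ∀ t → ∃ (Realizer t) → Realizer t (choose t)
      choose-realizes t z with em {P = ∃ (Realizer t)}
      ... | yes (_ , z∈) = z∈
      ... | no ¬z        = ⊥-elim (¬z z)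
      representative : ∀ z → x < z →
        ∃[ z′ ] (x < z′ × z′ < b × profile q (A ↑ x) z′ ≡ profile q (A ↑ x) z)
      representative z x<z =
        let t = profile q (A ↑ x) z
            x<z′ , e = choose-realizes t (z , x<z , refl)
        in choose t , x<z′ , proj₂ (finite-bounded choose) t , e

    closed-unbounded : ∀ β → ∃[ δ ] (β < δ × Closed δ)
    closed-unbounded β =
      let δ , β<δ , f<δ = closure-point (proj₁ ∘ representatives-bounded) β
      in δ , β<δ , λ x z x<δ x<z →
        let z′ , x<z′ , z′<b , e = proj₂ (representatives-bounded x) x<z
        in z′ , x<z′ , <-trans z′<b (f<δ x<δ) , e

    -- The answer to a move `z` beyond `δ` is a `z′` below `δ` of the same profile. It remains to
    -- compare the points between `z′` and `δ` with all points after `z′`, the same claim at a later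
    -- left end and with one round fewer.
    ↑↓-closed : ∀ {δ} → Closed δ → ∀ k → k ≤ q → ∀ {x} → x < δ → A ↑ x ↓ δ ≈[ k ] A ↑ x
    ↑↓-closed closed zero _ _ = tt
    ↑↓-closed {δ} closed (suc k) k<q {x} x<δ = forth , back
      where
      lower-part : ∀ {z} → z < δ → A ↑ x ↓ δ ↓ z ≈[ k ] A ↑ x ↓ z
      lower-part z<δ = ≈-ext k (λ ((a , _) , b) → a , b) (λ (a , b) → (a , <-trans b z<δ) , b)
      tail : ∀ {z} → x < z → A ↑ x ↑ z ≈[ k ] A ↑ z
      tail x<z = ≈-ext k (λ (_ , b) → tt , b) (λ (_ , b) → (tt , <-trans x<z b) , b)
      upper-part : ∀ {z} → x < z → z < δ → A ↑ x ↓ δ ↑ z ≈[ k ] A ↑ x ↑ z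
      upper-part x<z z<δ = ≈-trans k
        (≈-ext k (λ ((_ , a) , b) → (tt , b) , a) (λ ((_ , b) , a) → ((tt , <-trans x<z b) , a) , b))
        (≈-trans k (↑↓-closed closed k (ℕ.<⇒≤ k<q) z<δ) (≈-sym k (tail x<z)))
      forth : A ↑ x ↓ δ ≼[ k ] A ↑ x
      forth z ((_ , x<z) , z<δ) = z , (tt , x<z) , refl , lower-part z<δ , upper-part x<z z<δ
      back : A ↑ x ≼[ k ] A ↑ x ↓ δ
      back z (_ , x<z) =
        let z′ , x<z′ , z′<δ , e = closed x z x<δ x<z
            c , l , r = profile-injective q (A ↑ x) (A ↑ x) e
        in z′ , ((tt , x<z′) , z′<δ) , sym c
         , ≈-trans k (≈-weaken-≤ (ℕ.<⇒≤ k<q) (≈-sym q (code-≈ q l))) (≈-sym k (lower-part z′<δ))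
         , ≈-trans k (≈-weaken-≤ (ℕ.<⇒≤ k<q) (≈-sym q (code-≈ q r))) (≈-sym k (upper-part x<z′ z′<δ))

    -- `Closed` speaks of open intervals, so the left end `a` is split off as a one-point summand.
    From↓-closed : ∀ {a δ} → Closed δ → a < δ → From a ↓ δ ≈[ q ] From a
    From↓-closed {a} {δ} closed a<δ = ≈-sum q {P = _≡ a} {_≡ a}
      (λ { {a} ((_ , _) , _) ((_ , y≮a) , _) refl y≢a → above y≮a y≢a })
      (λ { {a} (_ , _) (_ , y≮a) refl y≢a → above y≮a y≢a })
      (≈-ext q (λ { ((b , _) , e) → b , e }) (λ { (b , refl) → (b , a<δ) , refl }))
      (≈-trans q (≈-ext q (λ (((_ , y≮a) , y<δ) , y≢a) → (tt , above y≮a y≢a) , y<δ)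
                          (λ ((_ , a<y) , y<δ) → ((tt , asym a<y) , y<δ) , λ { refl → irrefl a<y }))
        (≈-trans q (↑↓-closed closed q ℕ.≤-refl a<δ)
          (≈-ext q (λ (_ , a<y) → (tt , asym a<y) , λ { refl → irrefl a<y })
                   (λ ((_ , y≮a) , y≢a) → tt , above y≮a y≢a))))
      where
      above : ∀ {a y} → ¬ y < a → ¬ y ≡ a → a < y
      above {a} {y} y≮a y≢a with compare a y
      ... | tri< a<y _ _ = a<y
      ... | tri≈ _ a≡y _ = ⊥-elim (y≢a (sym a≡y))
      ... | tri> _ _ y<a = ⊥-elim (y≮a y<a)

    abstract
      -- Pigeonhole: if each code stopped occurring at closed points past some bound, a closed point
      -- past all these finitely many bounds could have no code.
      recurrent-code : ∃[ t ] (∀ β → ∃[ δ ] (β < δ × Closed δ × code q (From δ) ≡ t))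
      recurrent-code = decidable-stable em λ none →
        let last = λ t → decidable-stable (em {P = ∃[ β ] (∀ {δ} → β < δ → Closed δ → ¬ code q (From δ) ≡ t)})
              λ ¬last → none (t , λ β → decidable-stable em λ ¬δ →
                ¬last (β , λ β<δ closed e → ¬δ (_ , β<δ , closed , e)))
            b , last<b = finite-bounded (proj₁ ∘ last)
            δ , b<δ , closed = closed-unbounded b
        in proj₂ (last (code q (From δ))) (<-trans (last<b _) b<δ) closed refl

      s : ℕ → Carrier
      s zero    = proj₁ (proj₂ recurrent-code inhabitant)
      s (suc n) = proj₁ (proj₂ recurrent-code (s n))

      s-step : ∀ n → s n < s (suc n)
      s-step n = proj₁ (proj₂ (proj₂ recurrent-code (s n)))

      s-closed : ∀ n → Closed (s n)
      s-closed zero    = proj₁ (proj₂ (proj₂ (proj₂ recurrent-code inhabitant)))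
      s-closed (suc n) = proj₁ (proj₂ (proj₂ (proj₂ recurrent-code (s n))))

      s-code : ∀ n → code q (From (s n)) ≡ proj₁ recurrent-code
      s-code zero    = proj₂ (proj₂ (proj₂ (proj₂ recurrent-code inhabitant)))
      s-code (suc n) = proj₂ (proj₂ (proj₂ (proj₂ recurrent-code (s n))))

    s-mono : ∀ {m n} → m ℕ.< n → s m < s n
    s-mono = sequence-mono s-step

    s-mono-≤ : ∀ {m n} → m ≤ n → ¬ s n < s m
    s-mono-≤ m≤n sn<sm with ℕ.m≤n⇒m<n∨m≡n m≤n
    ... | inj₁ m<n  = asym sn<sm (s-mono m<n)
    ... | inj₂ refl = irrefl sn<sm

    abstract
      δ : Carrier
      δ = proj₁ (supremum s)

      s<δ : ∀ n → s n < δ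
      s<δ = proj₁ (proj₂ (supremum s))

      s-cofinal : ∀ {x} → x < δ → ∃[ n ] x < s n
      s-cofinal x<δ = let n , sn≮x = proj₂ (proj₂ (supremum s)) x<δ in suc n , ≮-<-trans sn≮x (s-step n)

    -- Each `x` below the supremum is below some `s n`, whose representatives serve for `δ` too.
    -- This brings in the sum of all ω blocks, which ends at `δ`.
    δ-closed : Closed δ
    δ-closed x z x<δ x<z =
      let n , x<sn = s-cofinal x<δ
          z′ , x<z′ , z′<sn , e = s-closed n x z x<sn x<z
      in z′ , x<z′ , <-trans z′<sn (s<δ n) , e

    M : Part d ℓ
    M = From (s 0) ↓ s 1

    From-s≈M : ∀ n → From (s n) ≈[ q ] M
    From-s≈M n = ≈-trans q (code-≈ q (trans (s-code n) (sym (s-code 0))))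
                           (≈-sym q (From↓-closed (s-closed 1) (s-step 0)))

    open Absorption q M

    InBlock : ℕ → Pred Carrier ℓ
    InBlock n z = ¬ z < s n × z < s (suc n)

    block-of : ∀ n {z} → ¬ z < s 0 → z < s n → ∃[ m ] InBlock m z
    block-of zero    z≮s0 z<s0 = ⊥-elim (z≮s0 z<s0)
    block-of (suc n) {z} z≮s0 z<s with em {P = z < s n}
    ... | yes z<sn = block-of n z≮s0 z<sn
    ... | no  z≮sn = n , z≮sn , z<s

    block-unique : ∀ {m n z} → InBlock m z → InBlock n z → m ≡ n
    block-unique {m} {n} (z≮sm , z<sm′) (z≮sn , z<sn′) with ℕ.<-cmp m n
    ... | tri< m<n _ _ = ⊥-elim (s-mono-≤ m<n (≮-<-trans z≮sn z<sm′))
    ... | tri≈ _ m≡n _ = m≡n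
    ... | tri> _ _ n<m = ⊥-elim (s-mono-≤ n<m (≮-<-trans z≮sm z<sn′))

    label : Carrier → Lift ℓ ℕ
    label z with em {P = ∃[ n ] InBlock n z}
    ... | yes (n , _) = lift n
    ... | no _        = lift 0

    label-block : ∀ {z} → From (s 0) ↓ δ ∋ z → InBlock (lower (label z)) z
    label-block {z} ((_ , z≮s0) , z<δ) with em {P = ∃[ n ] InBlock n z}
    ... | yes (_ , z∈) = z∈
    ... | no ¬n        = ⊥-elim (¬n (let n , z<sn = s-cofinal z<δ in block-of n z≮s0 z<sn))

    ≮s0 : ∀ n {z} → ¬ z < s n → ¬ z < s 0
    ≮s0 n z≮sn z<s0 = s-mono-≤ z≤n (≮-<-trans z≮sn z<s0)

    ω-blocks : Blocks (ω ℓ)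
    ω-blocks = record
      { whole = From (s 0) ↓ δ
      ; label = label
      ; mono  = λ x∈ y∈ (lift l) →
          let x<s = proj₂ (label-block x∈) ; y≮s = proj₁ (label-block y∈)
          in <-≮-trans x<s λ y<s → s-mono-≤ l (≮-<-trans y≮s y<s)
      ; block = λ (lift n) → ≈-trans q
          (≈-ext q
            (λ { (z∈ , e) → let z≮ , z< = subst (λ m → InBlock m _) (cong lower e) (label-block z∈) in (tt , z≮) , z< })
            (λ ((_ , z≮) , z<) → let z∈ = (tt , ≮s0 n z≮) , <-trans z< (s<δ (suc n)) in
              z∈ , cong lift (block-unique (label-block z∈) (z≮ , z<))))
          (≈-trans q (From↓-closed (s-closed (suc n)) (s-step n)) (From-s≈M n))
      }

    absorbed : AbsorbedUpTo q
    absorbed = absorb ω-blocks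
      (λ n → ≈-trans q
        (≈-ext q
          (λ { (z∈@(z≥s0 , _) , lift l) → z≥s0 , <-≮-trans (proj₂ (label-block z∈)) (s-mono-≤ l) })
          (λ (z≥s0 , z<s) → let z∈ = z≥s0 , <-trans z<s (s<δ (suc n)) in
            z∈ , lift (ℕ.≰⇒> λ l → s-mono-≤ l (≮-<-trans (proj₁ (label-block z∈)) z<s))))
        (≈-trans q (From↓-closed (s-closed (suc n)) (s-mono (s≤s z≤n))) (From-s≈M 0)))
      (≈-trans q (≈-ext q proj₁ (λ z∈ → z∈ , tt))
        (≈-trans q (From↓-closed δ-closed (s<δ 0)) (From-s≈M 0)))
      q ℕ.≤-refl

  -- A coloured ordinal on κ

  module Comparison (S : Part d ℓ) (wf : WellFounded (less S)) (κ : Ordinal ℓ) where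

    open WellOrder κ
    private module S = Chain (chain S)

    Rank-functional : ∀ {x u v} → Rank S κ x u → Rank S κ x v → u ≡ v
    Rank-functional {x} = go (wf x)
      where
      go : ∀ {x u v} → Acc (less S) x → Rank S κ x u → Rank S κ x v → u ≡ v
      go {u = u} {v} (acc rs) (rank f g) (rank f′ g′) with compare u v
      ... | tri≈ _ u≡v _ = u≡v
      ... | tri< u<v _ _ =
        let y , y∈S , y<x , r = g′ u<v
            w , w<u , r′ = f y∈S y<x
        in ⊥-elim (irrefl (subst (_< u) (go (rs y<x) r′ r) w<u))
      ... | tri> _ _ v<u =
        let y , y∈S , y<x , r = g v<u
            w , w<v , r′ = f′ y∈S y<x
        in ⊥-elim (irrefl (subst (_< v) (go (rs y<x) r′ r) w<v))

    Rank-mono : ∀ {x y u v} → S ∋ x → x <[ S ] y → Rank S κ x u → Rank S κ y v → u < v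
    Rank-mono x∈S x<y r (rank f _) =
      let w , w<v , r′ = f x∈S x<y in subst (_< _) (Rank-functional r′ r) w<v

    Rank-injective : ∀ {x y v} → S ∋ x → S ∋ y → Rank S κ x v → Rank S κ y v → x ≡ y
    Rank-injective {x} {y} x∈S y∈S r r′ with S.compare x y
    ... | tri< x<y _ _ = ⊥-elim (irrefl (Rank-mono x∈S x<y r r′))
    ... | tri≈ _ x≡y _ = x≡y
    ... | tri> _ _ y<x = ⊥-elim (irrefl (Rank-mono y∈S y<x r′ r))

    Rank-from-mono : ∀ {x y u v} → S ∋ x → S ∋ y → Rank S κ x u → Rank S κ y v → u < v → x <[ S ] y
    Rank-from-mono {x} {y} x∈S y∈S r r′ u<v with S.compare x y
    ... | tri< x<y _ _ = x<y
    ... | tri≈ _ refl _ = ⊥-elim (irrefl (subst (_< _) (Rank-functional r r′) u<v))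
    ... | tri> _ _ y<x = ⊥-elim (asym u<v (Rank-mono y∈S y<x r′ r))

    -- At a minimal unranked `m` the ranks of the points below form an initial segment of `κ`. It is
    -- not all of `κ` by hypothesis, and its least missing element would be the rank of `m`.
    total : (∀ x → S ∋ x → ¬ (∀ v → ∃[ y ] (S ∋ y × y <[ S ] x × Rank S κ y v))) →
            ∀ x → S ∋ x → ∃ (Rank S κ x)
    total κ≰x x x∈S = decidable-stable em λ unranked →
      let m , (m∈S , m-unranked) , m-least = minimal wf {λ x → S ∋ x × ¬ ∃ (Rank S κ x)} (x , x∈S , unranked)
          ranked-below = λ {y} (y∈S : S ∋ y) y<m → decidable-stable (em {P = ∃ (Rank S κ y)})
            λ ¬r → m-least (y∈S , ¬r) y<m
      in κ≰x m m∈S λ v → decidable-stable em λ v-missed →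
        let u , u-missed , u-least = least {P = λ v → ¬ (∃[ y ] (S ∋ y × y <[ S ] m × Rank S κ y v))} (v , v-missed)
        in m-unranked (u , rank
             (λ {y} y∈S y<m → let w , r = ranked-below y∈S y<m in
                w , below u-missed y∈S y<m r , r)
             (λ w<u → decidable-stable em λ w-missed → u-least w-missed w<u))
      where
      below : ∀ {m u} → ¬ (∃[ y ] (S ∋ y × y <[ S ] m × Rank S κ y u)) →
              ∀ {y w} → S ∋ y → y <[ S ] m → Rank S κ y w → w < u
      below {m} {u} u-missed {y} {w} y∈S y<m r@(rank _ g) with compare w u
      ... | tri< w<u _ _ = w<u
      ... | tri≈ _ refl _ = ⊥-elim (u-missed (y , y∈S , y<m , r))
      ... | tri> _ _ u<w = let z , z∈S , z<y , r′ = g u<w in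
        ⊥-elim (u-missed (z , z∈S , S.<-trans z<y y<m , r′))

    -- The ranks form an initial segment, so a missed `v` would lie above all of them.
    surjective : (∀ v → ¬ (∀ x → S ∋ x → ∃[ u ] (u < v × Rank S κ x u))) →
                 (∀ x → S ∋ x → ∃ (Rank S κ x)) →
                 ∀ v → ∃[ x ] (S ∋ x × Rank S κ x v)
    surjective S≰v ranked v = decidable-stable em λ v-missed →
      S≰v v λ x x∈S → let u , r = ranked x x∈S in u , below v-missed x∈S r , r
      where
      below : ∀ {v} → ¬ (∃[ x ] (S ∋ x × Rank S κ x v)) → ∀ {x u} → S ∋ x → Rank S κ x u → u < v
      below {v} v-missed {x} {u} x∈S r@(rank _ g) with compare u v
      ... | tri< u<v _ _ = u<v
      ... | tri≈ _ refl _ = ⊥-elim (v-missed (x , x∈S , r))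
      ... | tri> _ _ v<u = let z , z∈S , _ , r′ = g v<u in ⊥-elim (v-missed (z , z∈S , r′))

  module Transfer {κ α : Ordinal ℓ}
                  (regκ : IsRegularUncountableCardinal κ) (regα : IsRegularUncountableCardinal α)
                  (𝔄 : ColoredOrdinal d α) (q : ℕ) where

    private
      -- One round more than asked for, so that `≈[ Q ]` is never vacuous: its first move yields the
      -- point of the hull of `M` in `N₁-inhabited`, without which the copies could be empty.
      Q = suc q
      X = ⟪ 𝔄 ⟫
      module κ = Regular κ regκ
      module X = Chain X

    open Tails regα 𝔄 Q
    open Absorption Q M

    a : X.Carrier
    a = s 0

    module N₀ = LöwenheimSkolem Q (A ↓ a)
    module N₁ = LöwenheimSkolem Q M

    Bottom : Pred κ.Carrier ℓ
    Bottom i = ∀ j → ¬ j κ.< i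

    InN₀ InN₁ : Pred X.Carrier ℓ
    InN₀ = N₀.hull ∋_
    InN₁ = N₁.hull ∋_

    N₀-below : ∀ {x} → InN₀ x → x X.< a
    N₀-below ((_ , x<a) , _) = x<a

    N₁-above : ∀ {x} → InN₁ x → ¬ x X.< a
    N₁-above (((_ , x≮a) , _) , _) = x≮a

    -- N₀ followed by κ many copies of N₁, with N₀ sharing index 0 with the first copy.

    S : Part d ℓ
    S = lexicographic κ X ↾ λ (i , x) → InN₁ x ⊎ (InN₀ x × Bottom i)

    First : Pred ∣ S ∣ ℓ
    First (i , x) = InN₀ x × Bottom i

    Rest : Part d ℓ
    Rest = S ∩ (¬_ ∘ First)

    Rest-N₁ : ∀ {i x} → Rest ∋ (i , x) → InN₁ x
    Rest-N₁ (x∈ , x∉) = [ id , ⊥-elim ∘ x∉ ] x∈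

    N₁-Rest : ∀ {i x} → InN₁ x → Rest ∋ (i , x)
    N₁-Rest x∈ = inj₁ x∈ , λ (x∈N₀ , _) → N₁-above x∈ (N₀-below x∈N₀)

    First-iso : Iso N₀.hull (S ∩ First)
    First-iso = record
      { R         = λ x (i , y) → x ≡ y × Bottom i
      ; to        = λ x x∈ →
          let i , _ , bottom = κ.least {P = λ _ → ⊤ {ℓ}} (κ.inhabitant , tt)
          in (i , x) , (inj₂ (x∈ , λ j → bottom tt) , x∈ , λ j → bottom tt) , refl , λ j → bottom tt
      ; from      = λ (i , y) (_ , y∈ , bottom) → y , y∈ , refl , bottom
      ; colours   = λ { (refl , _) → refl }
      ; to-mono   = λ { {y = i , _} {j , _} (refl , bi) (refl , bj) x<y → inj₂ (bottoms bi bj , x<y) }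
      ; from-mono = λ { (refl , bi) (refl , bj) (inj₁ i<j) → ⊥-elim (bj _ i<j)
                      ; (refl , bi) (refl , bj) (inj₂ (_ , x<y)) → x<y }
      }
      where
      bottoms : ∀ {i j} → Bottom i → Bottom j → i ≡ j
      bottoms {i} {j} bi bj with κ.compare i j
      ... | tri< i<j _ _ = ⊥-elim (bj i i<j)
      ... | tri≈ _ i≡j _ = i≡j
      ... | tri> _ _ j<i = ⊥-elim (bi j j<i)

    copies : Blocks κ
    copies = record
      { whole = Rest
      ; label = proj₁
      ; mono  = λ _ _ → inj₁
      ; block = λ i → ≈-trans Q {T = N₁.hull} (≈-sym Q {S = N₁.hull} (Iso⇒≈ Q (copy i))) N₁.hull-≈
      }
      where
      copy : ∀ i → Iso N₁.hull (Rest ∩ (λ w → proj₁ w ≡ i))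
      copy i = record
        { R         = λ x (j , y) → x ≡ y × j ≡ i
        ; to        = λ x x∈ → (i , x) , (N₁-Rest x∈ , refl) , refl , refl
        ; from      = λ (j , y) (y∈ , j≡i) → y , Rest-N₁ y∈ , refl , j≡i
        ; colours   = λ { (refl , _) → refl }
        ; to-mono   = λ { (refl , refl) (refl , refl) x<y → inj₂ (refl , x<y) }
        ; from-mono = λ { (refl , refl) (refl , refl) (inj₁ i<i) → ⊥-elim (κ.irrefl i<i)
                        ; (refl , refl) (refl , refl) (inj₂ (_ , x<y)) → x<y }
        }

    A≈S : A ≈[ Q ] S
    A≈S = ≈-sum Q {P = X._< a} {First} A-cut S-cut
      (≈-trans Q {T = N₀.hull} (≈-sym Q {S = N₀.hull} N₀.hull-≈) (Iso⇒≈ Q First-iso))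
      (≈-trans Q {T = M} (From-s≈M 0) (≈-sym Q {S = Rest}
        (≈-trans Q {T = copies ∥ (λ _ → ⊤)} (≈-ext Q (λ x∈ → x∈ , tt) proj₁)
          (absorbed copies (λ _ → ⊤) (κ.inhabitant , tt)))))
      where
      A-cut : ∀ {x y} → A ∋ x → A ∋ y → x X.< a → ¬ y X.< a → x X.< y
      A-cut {x} {y} _ _ x<a y≮a with X.compare x y
      ... | tri< x<y _ _ = x<y
      ... | tri≈ _ refl _ = ⊥-elim (y≮a x<a)
      ... | tri> _ _ y<x = ⊥-elim (y≮a (X.<-trans y<x x<a))
      S-cut : Cut S First
      S-cut {i , x} {j , y} _ y∈ (x∈ , bottom) y∉ with κ.compare i j
      ... | tri< i<j _ _ = inj₁ i<j
      ... | tri≈ _ i≡j _ = inj₂ (i≡j , A-cut tt tt (N₀-below x∈) (N₁-above (Rest-N₁ (y∈ , y∉))))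
      ... | tri> _ _ j<i = ⊥-elim (bottom j j<i)

    S-wellFounded : WellFounded (less S)
    S-wellFounded = ×-wellFounded (Ordinal.wellFounded κ) (Ordinal.wellFounded α)

    open Comparison S S-wellFounded κ

    N₁-inhabited : ∃ InN₁
    N₁-inhabited =
      let x , x∈ , _ = proj₂ N₁.hull-≈ (s 0) ((tt , λ s0<s0 → X.irrefl refl s0<s0) , s-step 0) in x , x∈

    -- This is where countable hulls pay off. A fibre lies in the union of two of them and each
    -- point has at most one rank, so only countably many ranks occur in it.
    fibre-bounded : ∀ i → ∃[ b ] (∀ {v} → ∃[ x ] (S ∋ (i , x) × Rank S κ (i , x) v) → v κ.< b)
    fibre-bounded i = κ.countable-bounded (e , λ v∈ v′∈ → e-inj v∈ v′∈)
      where
      InFibre : κ.Carrier → Pred X.Carrier ℓ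
      InFibre v x = S ∋ (i , x) × Rank S κ (i , x) v
      countable : Countable (λ x → InN₁ x ⊎ InN₀ x)
      countable = Countable-∪ {P = InN₁} {InN₀} N₁.hull-countable N₀.hull-countable
      e : κ.Carrier → ℕ
      e v with em {P = ∃ (InFibre v)}
      ... | yes (x , _) = proj₁ countable x
      ... | no _        = 0
      point : ∀ {x} → S ∋ (i , x) → InN₁ x ⊎ InN₀ x
      point = [ inj₁ , inj₂ ∘ proj₁ ]
      e-inj : ∀ {v v′} → ∃ (InFibre v) → ∃ (InFibre v′) → e v ≡ e v′ → v ≡ v′
      e-inj {v} {v′} v∈ v′∈ eq with em {P = ∃ (InFibre v)} | em {P = ∃ (InFibre v′)}
      ... | no v∉ | _ = ⊥-elim (v∉ v∈)
      ... | _ | no v′∉ = ⊥-elim (v′∉ v′∈)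
      ... | yes (x , x∈ , r) | yes (y , y∈ , r′) with refl ← proj₂ countable (point x∈) (point y∈) eq =
        Rank-functional r r′

    -- Otherwise κ would be a union of fewer than κ countable, hence bounded, fibres.

    κ≰initial : ∀ w → S ∋ w → ¬ (∀ v → ∃[ y ] (S ∋ y × y <[ S ] w × Rank S κ y v))
    κ≰initial (i , _) _ covered =
      -- Points below `w` may share its index `i`, so the bound is taken over the indices below some
      -- `i′` above `i`.
      let i′ , i<i′ = κ.unbounded i
          c , f<c = κ.bounded i′ (λ (j , _) → proj₁ (fibre-bounded j))
          (j , y) , y∈ , y<w , r = covered c
      in κ.asym (f<c (j , below i<i′ y<w)) (proj₂ (fibre-bounded j) (y , y∈ , r))
      where
      below : ∀ {i i′ j x y} → i κ.< i′ → (j , y) <[ S ] (i , x) → j κ.< i′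
      below i<i′ (inj₁ j<i)        = κ.<-trans j<i i<i′
      below i<i′ (inj₂ (refl , _)) = i<i′

    -- The copies of one fixed point of `N₁` have ranks that increase along `κ`, so no `v` bounds
    -- them.
    S≰initial : ∀ v → ¬ (∀ w → S ∋ w → ∃[ u ] (u κ.< v × Rank S κ w u))
    S≰initial v ranked =
      κ.increasing⇒unbounded {h = λ i → proj₁ (h i)}
        (λ {i} {j} i<j → Rank-mono (inj₁ x∈) (inj₁ i<j) (proj₂ (proj₂ (h i))) (proj₂ (proj₂ (h j))))
        (λ i → proj₁ (proj₂ (h i)))
      where
      x∈ : InN₁ (proj₁ N₁-inhabited)
      x∈ = proj₂ N₁-inhabited
      h : ∀ i → ∃[ u ] (u κ.< v × Rank S κ (i , proj₁ N₁-inhabited) u)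
      h i = ranked (i , _) (inj₁ x∈)

    ranked : ∀ w → S ∋ w → ∃ (Rank S κ w)
    ranked = total κ≰initial

    unrank : ∀ v → ∃[ w ] (S ∋ w × Rank S κ w v)
    unrank = surjective S≰initial ranked

    𝔅 : ColoredOrdinal d κ
    𝔅 = record
      { Color     = λ i v → ColoredOrdinal.Color 𝔄 i (proj₂ (proj₁ (unrank v)))
      ; partition = λ v → ColoredOrdinal.partition 𝔄 (proj₂ (proj₁ (unrank v)))
      }

    S-iso : Iso S (Whole ⟪ 𝔅 ⟫)
    S-iso = record
      { R         = λ w v → S ∋ w × Rank S κ w v
      ; to        = λ w w∈ → let v , r = ranked w w∈ in v , tt , w∈ , r
      ; from      = λ v _ → let w , w∈ , r = unrank v in w , w∈ , w∈ , r
      ; colours   = λ {_} {v} (w∈ , r) → let w′ , w′∈ , r′ = unrank v in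
          cong (X.colour ∘ proj₂) (Rank-injective w∈ w′∈ r r′)
      ; to-mono   = λ (w∈ , r) (_ , r′) w<w′ → Rank-mono w∈ w<w′ r r′
      ; from-mono = λ (w∈ , r) (w′∈ , r′) v<v′ → Rank-from-mono w∈ w′∈ r r′ v<v′
      }

    𝔄≡𝔅 : 𝔄 ≡[ q ] 𝔅
    𝔄≡𝔅 = ≈⇒≡ 𝔄 𝔅 q (≈-weaken q (≈-trans Q {A} {S} A≈S (Iso⇒≈ Q S-iso)))

theorem12 : (∀ {a} → ExcludedMiddle a) →
    ∀ {ℓ} (d : ℕ) → 1 ≤ d →
    (κ λ′ : Ordinal ℓ) →
    IsRegularUncountableCardinal κ → IsRegularUncountableCardinal λ′ →
    (q : ℕ) (𝔄 : ColoredOrdinal d λ′) →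
    Σ[ 𝔅 ∈ ColoredOrdinal d κ ] 𝔄 ≡[ q ] 𝔅
theorem12 em d 1≤d κ λ′ regκ regλ q 𝔄 = 𝔅 , 𝔄≡𝔅
  where open Transfer em regκ regλ 𝔄 q
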